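{- Let $m\ge 1$ be a fixed integer. Then $$\{a^*_{mn}(j):n\ge 1,\ j\ge 0\}=\{c^*_{mn}(j):n\ge 1,\ j\ge 0\}=\mathbb Z.$$
   Context: A divisor $d$ of $n$ is a unitary divisor, written $d\,\|\,n$, if $\gcd(d,n/d)=1$. Let $\omega(n)$ be the number of distinct prime factors of $n$ and $\mu^*(n)=(-1)^{\omega(n)}$. The unitary cyclotomic polynomial is $\Phi^*_n(x)=\prod_{d\,\|\,n}(x^{d}-1)^{\mu^*(n/d)}$ (a monic polynomial with integer coefficients; equivalently $x^n-1=\prod_{d\,\|\,n}\Phi^*_d(x)$ for all $n$), and the inverse unitary cyclotomic polynomial is $\Psi^*_n(x)=(x^n-1)/\Phi^*_n(x)$, also a polynomial with integer coefficients. Their coefficients are defined for all $j\ge0$ by $\Phi^*_n(x)=\sum_{j\ge0}a^*_n(j)x^j$ and $\Psi^*_n(x)=\sum_{j\ge0}c^*_n(j)x^j$ (so they are $0$ beyond the degree). -}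

module Defs where

open import Data.Nat using (ℕ; zero; suc; _∸_; _≟_)
open import Data.Nat.Divisibility using (_∣?_)
open import Data.Nat.GCD using (gcd)
open import Data.Nat.Primality using (prime?)
open import Data.Nat.DivMod using (_/_)
open import Data.Integer using (ℤ; +_; -_; _*_; _+_)
open import Data.List using (List; []; _∷_; upTo; length; foldr; map)
open import Data.Bool using (Bool; true; false; _∧_; if_then_else_; not)
open import Relation.Nullary.Decidable using (does)

-- formal power series with integer coefficients: j ↦ coefficient of x^j
Series : Set
Series = ℕ → ℤ

conv : Series → Series → ℕ → ℕ → ℤ
conv f g j zero    = f 0 * g j
conv f g j (suc i) = f (suc i) * g (j ∸ suc i) + conv f g j i

mul : Series → Series → Series
mul f g j = conv f g j j

one : Series
one zero    = + 1
one (suc _) = + 0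

xPowMinus1 : ℕ → Series
xPowMinus1 d j = (if does (j ≟ d) then + 1 else + 0) + (if does (j ≟ 0) then - + 1 else + 0)

-- (x^d - 1)^{-1} = - Σ_{k ≥ 0} x^{dk}   (valid for d ≥ 1)
invXPowMinus1 : ℕ → Series
invXPowMinus1 d j = if does (d ∣? j) then - + 1 else + 0

bfilter : {A : Set} → (A → Bool) → List A → List A
bfilter p []       = []
bfilter p (x ∷ xs) = if p x then x ∷ bfilter p xs else bfilter p xs

isEven : ℕ → Bool
isEven zero    = true
isEven (suc k) = not (isEven k)

ω : ℕ → ℕ
ω n = length (bfilter (λ p → does (prime? p) ∧ does (p ∣? n)) (upTo (suc n)))

-- μ*(n) = (-1)^{ω(n)} ; true means +1
μ*Pos : ℕ → Bool
μ*Pos n = isEven (ω n)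

isUnitary : ℕ → ℕ → Bool
isUnitary n zero    = false
isUnitary n (suc e) = does (suc e ∣? n) ∧ does (gcd (suc e) (n / suc e) ≟ 1)

unitaryDivisors : ℕ → List ℕ
unitaryDivisors n = bfilter (isUnitary n) (map suc (upTo n))

factor : Bool → ℕ → Series
factor true  d = xPowMinus1 d
factor false d = invXPowMinus1 d

-- n / d, with n / 0 := 0 (never used: unitary divisors are ≥ 1)
divN : ℕ → ℕ → ℕ
divN n zero    = 0
divN n (suc e) = n / suc e

-- Φ*_n(x) = ∏_{d ∥ n} (x^d - 1)^{μ*(n/d)}, as a power series (it is a polynomial)
Φ* : ℕ → Series
Φ* n = foldr (λ d acc → mul (factor (μ*Pos (divN n d)) d) acc) one (unitaryDivisors n)

-- Ψ*_n(x) = (x^n - 1) / Φ*_n(x) = (x^n - 1) · ∏_{d ∥ n} (x^d - 1)^{-μ*(n/d)}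
Ψ* : ℕ → Series
Ψ* n = mul (xPowMinus1 n)
          (foldr (λ d acc → mul (factor (not (μ*Pos (divN n d))) d) acc) one (unitaryDivisors n))

a* : ℕ → ℕ → ℤ
a* n j = Φ* n j

c* : ℕ → ℕ → ℤ
c* n j = Ψ* n j

module Submission where

-- For pairwise coprime prime powers q₁ , … , qₗ whose pairwise products all exceed J, only the unitary divisors
-- 1 and qᵢ of N = mn = q₁ ⋯ qₗ matter modulo x^(J+1), so Φ*_N ≡ (1 - x)^σ ∏ᵢ (1 - x^qᵢ)^(-σ) with σ = (-1)^l.
-- The prime powers of m can be raised above J, and one more huge prime gives σ the desired value.
-- Take a prime r and t further prime powers q ≡ 1 (mod r), the largest being at least 2 less than the sum of any two.
-- With σ = 1 the series becomes (1 - x)/(1 - x^r) · (1 + Σ x^q) modulo x^(J+1), whose coefficient is t - 1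
-- at j = max q and -t at j = max q + 1.
-- Such q exist by the pigeonhole principle: the exponents of each prime are free, and ⌊3 p^a / 2^n⌋ (for 2^n ≤ p^a < p 2^n)
-- and p^a mod r take finitely many values. For Ψ*_N use that it agrees with -1/Φ*_N below degree N.

open import Defs
open import Data.Nat
open import Data.Integer using (ℤ)
open import Data.Product using (_×_; _,_; ∃-syntax; Σ-syntax; proj₁; proj₂; map₁; map₂)
open import Relation.Binary.PropositionalEquality using (_≡_; _≢_; refl; sym; trans; cong; cong₂; subst; subst₂; _≗_; module ≡-Reasoning)
open import Algebra.Bundles using (CommutativeMonoid)
open import Data.Bool using (Bool; true; false; if_then_else_; _∧_; not)
open import Data.Bool.Properties using (not-involutive)
open import Data.Fin using (Fin; zero; suc; fromℕ<; toℕ; combine; funToFin; finToFun)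
import Data.Fin.Properties as Fin
import Data.Integer as ℤ
import Data.Integer.Properties as ℤ
open import Data.Integer.Tactic.RingSolver using () renaming (solve-∀ to ℤ-solve-∀)
open import Data.List using (List; []; _∷_; _++_; foldr; length; upTo; map; tabulate)
open import Data.List.Membership.Propositional using (_∈_; find)
open import Data.List.Membership.Propositional.Properties using (∈-upTo⁺; ∈-map⁺; ∈-map⁻; ∈-++⁺ˡ; ∈-++⁺ʳ; ∈-++⁻; ∈-tabulate⁻)
open import Data.List.Membership.Propositional.Properties.WithK using (unique∧set⇒bag)
open import Data.List.Properties using (map-++; map-∘; map-cong-local; foldr-map; foldr-++; length-map; length-++; length-tabulate)
open import Data.List.Relation.Binary.BagAndSetEquality using (∼bag⇒↭)
import Data.List.Relation.Binary.Permutation.Propositional as Perm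
import Data.List.Relation.Binary.Permutation.Propositional.Properties as Perm
open import Data.List.Relation.Binary.Permutation.Propositional using (_↭_; ↭-refl)
open import Data.List.Relation.Unary.All as All using (All; []; _∷_)
import Data.List.Relation.Unary.All.Properties as All
open import Data.List.Relation.Unary.AllPairs using (AllPairs; []; _∷_)
import Data.List.Relation.Unary.AllPairs.Properties as AllPairs
open import Data.List.Relation.Unary.Any as Any using (Any; here; there)
open import Data.List.Relation.Unary.Unique.Propositional using (Unique)
import Data.List.Relation.Unary.Unique.Propositional.Properties as Unique
open import Data.Nat.Coprimality as Coprime using (Coprime; coprime-divisor; coprime⇒gcd≡1; gcd≡1⇒coprime)
open import Data.Nat.DivMod using (m≡m%n+[m/n]*n; m%n<n; m/n*n≤m; m<n*o⇒m/o<n; m*n/n≡m; m*[n/m]≡n; /-monoˡ-≤; /-congˡ)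
open import Data.Nat.Divisibility
open import Data.Nat.GCD using (gcd)
open import Data.Nat.Induction using (<-rec)
open import Data.Nat.ListAction using (product)
open import Data.Nat.ListAction.Properties using (product-++; ∈⇒∣product)
open import Data.Nat.Primality using (Prime; prime?; prime⇒irreducible; prime⇒nonZero; prime⇒nonTrivial; ¬prime[1]; euclidsLemma)
open import Data.Nat.Primality.Factorisation using (factorise)
import Data.Nat.Properties as ℕ
open import Data.Nat.Tactic.RingSolver using () renaming (solve-∀ to ℕ-solve-∀)
open import Data.Sum using (_⊎_; inj₁; inj₂)
open import Function using (mk⇔; _∘_)
open import Level using (0ℓ)
open import Relation.Binary using (tri<; tri≈; tri>)
import Relation.Binary.Reasoning.Setoid as SetoidReasoning
open import Relation.Nullary using (¬_; Dec; yes; no; contradiction)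
open import Relation.Nullary.Decidable using (does; dec-true; dec-false)

-- Power series

tail : Series → Series
tail f j = f (suc j)

conv-cong : ∀ {f f′ g g′ : Series} j i → (∀ k → k ≤ j → f k ≡ f′ k) → (∀ k → k ≤ j → g k ≡ g′ k) →
  i ≤ j → conv f g j i ≡ conv f′ g′ j i
conv-cong j zero f≈ g≈ _ = cong₂ ℤ._*_ (f≈ 0 z≤n) (g≈ j ℕ.≤-refl)
conv-cong j (suc i) f≈ g≈ i<j = cong₂ ℤ._+_
  (cong₂ ℤ._*_ (f≈ (suc i) i<j) (g≈ (j ∸ suc i) (ℕ.m∸n≤m j (suc i))))
  (conv-cong j i f≈ g≈ (ℕ.<⇒≤ i<j))

conv-cong₁ : ∀ {f f′ : Series} (g : Series) → f ≗ f′ → ∀ j → mul f g j ≡ mul f′ g j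
conv-cong₁ g f≈ j = conv-cong j j (λ k _ → f≈ k) (λ _ _ → refl) ℕ.≤-refl

-- `conv` unfolds from the highest index of `f`. Splitting off index 0 instead, by f = f(0) + x ·
-- `tail f`, gives the recursion on which the inductions for commutativity and associativity run.
conv-tailˡ : ∀ f g j i → conv f g (suc j) (suc i) ≡ f 0 ℤ.* g (suc j) ℤ.+ conv (tail f) g j i
conv-tailˡ f g j zero = ℤ.+-comm (f 1 ℤ.* g j) _
conv-tailˡ f g j (suc i) rewrite conv-tailˡ f g j i =
  lem (f (suc (suc i)) ℤ.* g (j ∸ suc i)) (f 0 ℤ.* g (suc j)) (conv (tail f) g j i)
  where
  lem : ∀ a b c → a ℤ.+ (b ℤ.+ c) ≡ b ℤ.+ (a ℤ.+ c)
  lem = ℤ-solve-∀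

-- The bound `i ≤ j` keeps the truncated subtraction exact, so that raising j by one raises every
-- index of `g` by one.
conv-tailʳ : ∀ f g j i → i ≤ j → conv f g (suc j) i ≡ conv f (tail g) j i
conv-tailʳ f g j zero _ = refl
conv-tailʳ f g j (suc i) i<j = cong₂ ℤ._+_
  (cong (λ k → f (suc i) ℤ.* g k) (ℕ.+-∸-assoc 1 i<j))
  (conv-tailʳ f g j i (ℕ.<⇒≤ i<j))

mul-tailˡ : ∀ f g j → mul f g (suc j) ≡ f 0 ℤ.* g (suc j) ℤ.+ mul (tail f) g j
mul-tailˡ f g j = conv-tailˡ f g j j

mul-comm : ∀ f g j → mul f g j ≡ mul g f j
mul-comm f g zero = ℤ.*-comm (f 0) (g 0)
mul-comm f g (suc j) = begin
  mul f g (suc j)                            ≡⟨ mul-tailˡ f g j ⟩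
  f 0 ℤ.* g (suc j) ℤ.+ mul (tail f) g j     ≡⟨ cong₂ ℤ._+_ (ℤ.*-comm (f 0) _) (mul-comm (tail f) g j) ⟩
  g (suc j) ℤ.* f 0 ℤ.+ mul g (tail f) j     ≡⟨ cong₂ ℤ._+_ (cong (λ k → g (suc j) ℤ.* f k) (ℕ.n∸n≡0 j))
                                                  (conv-tailʳ g f j j ℕ.≤-refl) ⟨
  mul g f (suc j)                            ∎
  where open ≡-Reasoning

-- Additivity and scaling in one statement: the shape needed both for `tail (mul f g)` in the proof
-- of associativity and for writing 1 - x^d as a combination of two monomials.
conv-linear : ∀ c f g h j i →
  conv (λ k → c ℤ.* f k ℤ.+ g k) h j i ≡ c ℤ.* conv f h j i ℤ.+ conv g h j i
conv-linear c f g h j zero = lem c (f 0) (g 0) (h j)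
  where
  lem : ∀ c f g h → (c ℤ.* f ℤ.+ g) ℤ.* h ≡ c ℤ.* (f ℤ.* h) ℤ.+ g ℤ.* h
  lem = ℤ-solve-∀
conv-linear c f g h j (suc i) rewrite conv-linear c f g h j i =
  lem c (f (suc i)) (g (suc i)) (h (j ∸ suc i)) (conv f h j i) (conv g h j i)
  where
  lem : ∀ c f g h x y → (c ℤ.* f ℤ.+ g) ℤ.* h ℤ.+ (c ℤ.* x ℤ.+ y) ≡ c ℤ.* (f ℤ.* h ℤ.+ x) ℤ.+ (g ℤ.* h ℤ.+ y)
  lem = ℤ-solve-∀

mul-assoc : ∀ f g h j → mul (mul f g) h j ≡ mul f (mul g h) j
mul-assoc f g h zero = ℤ.*-assoc (f 0) (g 0) (h 0)
mul-assoc f g h (suc j) = begin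
  mul (mul f g) h (suc j)
    ≡⟨ mul-tailˡ (mul f g) h j ⟩
  f 0 ℤ.* g 0 ℤ.* h (suc j) ℤ.+ mul (tail (mul f g)) h j
    ≡⟨ cong (λ z → f 0 ℤ.* g 0 ℤ.* h (suc j) ℤ.+ z) (begin
         mul (tail (mul f g)) h j
           ≡⟨ conv-cong₁ h (mul-tailˡ f g) j ⟩
         mul (λ k → f 0 ℤ.* tail g k ℤ.+ mul (tail f) g k) h j
           ≡⟨ conv-linear (f 0) (tail g) (mul (tail f) g) h j j ⟩
         f 0 ℤ.* mul (tail g) h j ℤ.+ mul (mul (tail f) g) h j
           ≡⟨ cong (λ z → f 0 ℤ.* mul (tail g) h j ℤ.+ z) (mul-assoc (tail f) g h j) ⟩
         f 0 ℤ.* mul (tail g) h j ℤ.+ mul (tail f) (mul g h) j ∎) ⟩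
  f 0 ℤ.* g 0 ℤ.* h (suc j) ℤ.+ (f 0 ℤ.* mul (tail g) h j ℤ.+ mul (tail f) (mul g h) j)
    ≡⟨ lem (f 0) (g 0) (h (suc j)) (mul (tail g) h j) (mul (tail f) (mul g h) j) ⟩
  f 0 ℤ.* (g 0 ℤ.* h (suc j) ℤ.+ mul (tail g) h j) ℤ.+ mul (tail f) (mul g h) j
    ≡⟨ cong (λ z → f 0 ℤ.* z ℤ.+ mul (tail f) (mul g h) j) (mul-tailˡ g h j) ⟨
  f 0 ℤ.* mul g h (suc j) ℤ.+ mul (tail f) (mul g h) j
    ≡⟨ mul-tailˡ f (mul g h) j ⟨
  mul f (mul g h) (suc j) ∎
  where
  open ≡-Reasoning
  lem : ∀ a b c x y → a ℤ.* b ℤ.* c ℤ.+ (a ℤ.* x ℤ.+ y) ≡ a ℤ.* (b ℤ.* c ℤ.+ x) ℤ.+ y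
  lem = ℤ-solve-∀

conv-zero : ∀ (f g : Series) j i → (∀ k → f k ≡ ℤ.+ 0) → conv f g j i ≡ ℤ.+ 0
conv-zero f g j zero f≈0 rewrite f≈0 0 = refl
conv-zero f g j (suc i) f≈0 rewrite f≈0 (suc i) | conv-zero f g j i f≈0 = refl

mul-identityˡ : ∀ f j → mul one f j ≡ f j
mul-identityˡ f zero = ℤ.*-identityˡ (f 0)
mul-identityˡ f (suc j) = begin
  mul one f (suc j)                                  ≡⟨ mul-tailˡ one f j ⟩
  ℤ.+ 1 ℤ.* f (suc j) ℤ.+ mul (tail one) f j         ≡⟨ cong₂ ℤ._+_ (ℤ.*-identityˡ (f (suc j)))
                                                          (conv-zero (tail one) f j j (λ _ → refl)) ⟩
  f (suc j) ℤ.+ ℤ.+ 0                                ≡⟨ ℤ.+-identityʳ _ ⟩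
  f (suc j)                                          ∎
  where open ≡-Reasoning

mul-identityʳ : ∀ f j → mul f one j ≡ f j
mul-identityʳ f j = trans (mul-comm f one j) (mul-identityˡ f j)

infix 4 _≈[_]_

_≈[_]_ : Series → ℕ → Series → Set
f ≈[ J ] g = ∀ j → j ≤ J → f j ≡ g j

-- Coefficient j of a product depends only on the coefficients of index at most j, so `mul` respects
-- congruence modulo x^(J+1), which is what `_≈[_]_` expresses.
mul-monoid : ℕ → CommutativeMonoid 0ℓ 0ℓ
mul-monoid J = record
  { Carrier = Series
  ; _≈_ = _≈[ J ]_
  ; _∙_ = mul
  ; ε = one
  ; isCommutativeMonoid = record
    { isMonoid = record
      { isSemigroup = record
        { isMagma = record
          { isEquivalence = record
            { refl = λ _ _ → refl
            ; sym = λ f≈g j j≤J → sym (f≈g j j≤J)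
            ; trans = λ f≈g g≈h j j≤J → trans (f≈g j j≤J) (g≈h j j≤J)
            }
          ; ∙-cong = λ f≈ g≈ j j≤J → conv-cong j j
              (λ k k≤j → f≈ k (ℕ.≤-trans k≤j j≤J)) (λ k k≤j → g≈ k (ℕ.≤-trans k≤j j≤J)) ℕ.≤-refl
          }
        ; assoc = λ f g h j _ → mul-assoc f g h j
        }
      ; identity = (λ f j _ → mul-identityˡ f j) , (λ f j _ → mul-identityʳ f j)
      }
    ; comm = λ f g j _ → mul-comm f g j
    }
  }

-- The factors (1 - x^d)^{±1} and their effect on coefficients

neg : Series → Series
neg f j = ℤ.- f j

mul-negˡ : ∀ f g j → mul (neg f) g j ≡ ℤ.- mul f g j
mul-negˡ f g j = conv-neg j
  where
  conv-neg : ∀ i → conv (neg f) g j i ≡ ℤ.- conv f g j i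
  conv-neg zero = sym (ℤ.neg-distribˡ-* (f 0) (g j))
  conv-neg (suc i) rewrite conv-neg i = lem (f (suc i)) (g (j ∸ suc i)) (conv f g j i)
    where
    lem : ∀ a b c → ℤ.- a ℤ.* b ℤ.+ ℤ.- c ≡ ℤ.- (a ℤ.* b ℤ.+ c)
    lem = ℤ-solve-∀

mul-negʳ : ∀ f g j → mul f (neg g) j ≡ ℤ.- mul f g j
mul-negʳ f g j = trans (mul-comm f (neg g) j) (trans (mul-negˡ g f j) (cong ℤ.-_ (mul-comm g f j)))

-- (1 - x^d)^{±1}
nfactor : Bool → ℕ → Series
nfactor b d = neg (factor b d)

monomial : ℕ → Series
monomial d k = if does (k ≟ d) then ℤ.+ 1 else ℤ.+ 0

shift : ℕ → Series → Series
shift d f j = if does (d ≤? j) then f (j ∸ d) else ℤ.+ 0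

shift-≤ : ∀ {d j} f → d ≤ j → shift d f j ≡ f (j ∸ d)
shift-≤ {d} {j} f d≤j rewrite dec-true (d ≤? j) d≤j = refl

shift-> : ∀ {d j} f → j < d → shift d f j ≡ ℤ.+ 0
shift-> {d} {j} f j<d rewrite dec-false (d ≤? j) (ℕ.<⇒≱ j<d) = refl

conv-monomial-> : ∀ {d} f j i → i < d → conv (monomial d) f j i ≡ ℤ.+ 0
conv-monomial-> {suc d} f j zero _ = refl
conv-monomial-> {d} f j (suc i) i<d rewrite dec-false (suc i ≟ d) (ℕ.<⇒≢ i<d) =
  trans (ℤ.+-identityˡ _) (conv-monomial-> f j i (ℕ.<⇒≤ i<d))

conv-monomial-≤ : ∀ {d} f j i → d ≤ i → conv (monomial d) f j i ≡ f (j ∸ d)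
conv-monomial-≤ {zero} f j zero _ = ℤ.*-identityˡ (f j)
conv-monomial-≤ {d} f j (suc i) d≤1+i with suc i ≟ d
... | yes refl rewrite dec-true (suc i ≟ suc i) refl = trans
  (cong₂ ℤ._+_ (ℤ.*-identityˡ (f (j ∸ suc i))) (conv-monomial-> f j i ℕ.≤-refl))
  (ℤ.+-identityʳ _)
... | no 1+i≢d rewrite dec-false (suc i ≟ d) 1+i≢d = trans (ℤ.+-identityˡ _)
  (conv-monomial-≤ f j i (ℕ.≤-pred (ℕ.≤∧≢⇒< d≤1+i λ d≡1+i → 1+i≢d (sym d≡1+i))))

mul-monomial : ∀ d f j → mul (monomial d) f j ≡ shift d f j
mul-monomial d f j with d ≤? j
... | yes d≤j = trans (conv-monomial-≤ f j j d≤j) (sym (shift-≤ f d≤j))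
... | no d≰j = trans (conv-monomial-> f j j (ℕ.≰⇒> d≰j)) (sym (shift-> f (ℕ.≰⇒> d≰j)))

mul-nfactor-true : ∀ d f j → mul (nfactor true d) f j ≡ f j ℤ.- shift d f j
mul-nfactor-true d f j = begin
  mul (nfactor true d) f j
    ≡⟨ conv-cong₁ f expand j ⟩
  mul (λ k → ℤ.-1ℤ ℤ.* monomial d k ℤ.+ monomial 0 k) f j
    ≡⟨ conv-linear ℤ.-1ℤ (monomial d) (monomial 0) f j j ⟩
  ℤ.-1ℤ ℤ.* mul (monomial d) f j ℤ.+ mul (monomial 0) f j
    ≡⟨ cong₂ (λ y z → ℤ.-1ℤ ℤ.* y ℤ.+ z) (mul-monomial d f j) (mul-monomial 0 f j) ⟩
  ℤ.-1ℤ ℤ.* shift d f j ℤ.+ f j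
    ≡⟨ lem (shift d f j) (f j) ⟩
  f j ℤ.- shift d f j ∎
  where
  open ≡-Reasoning
  lem : ∀ y z → ℤ.-1ℤ ℤ.* y ℤ.+ z ≡ z ℤ.- y
  lem = ℤ-solve-∀
  expand : ∀ k → nfactor true d k ≡ ℤ.-1ℤ ℤ.* monomial d k ℤ.+ monomial 0 k
  expand k with does (k ≟ d) | does (k ≟ 0)
  ... | true | true = refl
  ... | true | false = refl
  ... | false | true = refl
  ... | false | false = refl

nfactor-false-∣ : ∀ {d j} → d ∣ j → nfactor false d j ≡ ℤ.+ 1
nfactor-false-∣ {d} {j} d∣j rewrite dec-true (d ∣? j) d∣j = refl

nfactor-false-∤ : ∀ {d j} → ¬ d ∣ j → nfactor false d j ≡ ℤ.+ 0
nfactor-false-∤ {d} {j} d∤j rewrite dec-false (d ∣? j) d∤j = refl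

∣-∸ : ∀ {c d n} → d ∣ n → d ∣ n ∸ c * d
∣-∸ {c} {d} (divides q refl) = divides (q ∸ c) (sym (ℕ.*-distribʳ-∸ d q c))

-- Telescoping: for j ≥ d > 0 the indicator of d ∣ j takes the same value at j and j - d, and for 0
-- < j < d both terms vanish.
nfactor-inverse : ∀ {d} → 1 ≤ d → ∀ j → mul (nfactor true d) (nfactor false d) j ≡ one j
nfactor-inverse {d} 1≤d j = trans (mul-nfactor-true d (nfactor false d) j) (lem j)
  where
  lem : ∀ j → nfactor false d j ℤ.- shift d (nfactor false d) j ≡ one j
  lem zero rewrite shift-> (nfactor false d) 1≤d | nfactor-false-∣ (d ∣0) = refl
  lem (suc j) with d ∣? suc j
  ... | yes d∣ rewrite shift-≤ (nfactor false d) (∣⇒≤ d∣) | nfactor-false-∣ (subst (λ k → d ∣ suc j ∸ k) (ℕ.*-identityˡ d) (∣-∸ {c = 1} d∣)) = refl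
  ... | no d∤ with d ≤? suc j
  ...   | yes d≤ rewrite shift-≤ (nfactor false d) d≤ | nfactor-false-∤ (λ d∣ → d∤ (∣m∸n∣n⇒∣m d d≤ d∣ ∣-refl)) = refl
  ...   | no d≰ rewrite shift-> (nfactor false d) (ℕ.≰⇒> d≰) = refl

-- The quotient h = f / (1 - x^d) satisfies (1 - x^d) h = f, that is, h = f + x^d h.
mul-nfactor-false : ∀ {d} → 1 ≤ d → ∀ f j →
  mul (nfactor false d) f j ≡ f j ℤ.+ shift d (mul (nfactor false d) f) j
mul-nfactor-false {d} 1≤d f j = begin
  h j                                       ≡⟨ lem (h j) (shift d h j) ⟩
  h j ℤ.- shift d h j ℤ.+ shift d h j       ≡⟨ cong (ℤ._+ shift d h j) (mul-nfactor-true d h j) ⟨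
  mul (nfactor true d) h j ℤ.+ shift d h j  ≡⟨ cong (ℤ._+ shift d h j) (mul-assoc (nfactor true d) (nfactor false d) f j) ⟨
  mul (mul (nfactor true d) (nfactor false d)) f j ℤ.+ shift d h j
    ≡⟨ cong (ℤ._+ shift d h j) (trans (conv-cong₁ f (nfactor-inverse 1≤d) j) (mul-identityˡ f j)) ⟩
  f j ℤ.+ shift d h j                       ∎
  where
  open ≡-Reasoning
  h = mul (nfactor false d) f
  lem : ∀ y z → y ≡ y ℤ.- z ℤ.+ z
  lem = ℤ-solve-∀

nfactor-false-< : ∀ {d} → 1 ≤ d → ∀ f j → j < d → mul (nfactor false d) f j ≡ f j
nfactor-false-< {d} 1≤d f j j<d =
  trans (mul-nfactor-false 1≤d f j) (trans (cong (λ z → f j ℤ.+ z) (shift-> h j<d)) (ℤ.+-identityʳ (f j)))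
  where h = mul (nfactor false d) f

nfactor-> : ∀ b {d J} → J < d → nfactor b d ≈[ J ] one
nfactor-> true {d} J<d j j≤J = begin
  nfactor true d j                   ≡⟨ mul-identityʳ (nfactor true d) j ⟨
  mul (nfactor true d) one j         ≡⟨ mul-nfactor-true d one j ⟩
  one j ℤ.- shift d one j            ≡⟨ cong (λ z → one j ℤ.- z) (shift-> one (ℕ.≤-<-trans j≤J J<d)) ⟩
  one j ℤ.- ℤ.+ 0                    ≡⟨ ℤ.+-identityʳ (one j) ⟩
  one j                              ∎
  where open ≡-Reasoning
nfactor-> false {d} J<d j j≤J = trans (sym (mul-identityʳ (nfactor false d) j))
  (nfactor-false-< (ℕ.≤-<-trans z≤n J<d) one j (ℕ.≤-<-trans j≤J J<d))

mulAll : Bool → Series → List ℕ → Series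
mulAll b g = foldr (λ q → mul (nfactor b q)) g

mulAll-< : ∀ g qs i → (∀ {q} → q ∈ qs → i < q) → mulAll false g qs i ≡ g i
mulAll-< g [] i _ = refl
mulAll-< g (q ∷ qs) i i< =
  trans (nfactor-false-< (ℕ.≤-<-trans z≤n (i< (here refl))) (mulAll false g qs) i (i< (here refl)))
        (mulAll-< g qs i (λ q∈ → i< (there q∈)))

-- Up to degree j the product of the 1 / (1 - x^q) is 1 + Σ x^q: every further monomial has degree
-- at least some q + q′ > j, where q = q′ is included. In the induction, j - q lies below every
-- element of the list, so there the product still agrees with `g`.
mulAll-linear : ∀ g qs j c → (∀ {q} → q ∈ qs → q ≤ j) → (∀ {q q′} → q ∈ qs → q′ ∈ qs → j < q + q′) →
  (∀ {q} → q ∈ qs → g (j ∸ q) ≡ c) → mulAll false g qs j ≡ g j ℤ.+ ℤ.+ length qs ℤ.* c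
mulAll-linear g [] j c _ _ _ = sym (ℤ.+-identityʳ (g j))
mulAll-linear g (q ∷ qs) j c ≤j j<+ g≡c = begin
  h j                                ≡⟨ mul-nfactor-false 1≤q (mulAll false g qs) j ⟩
  mulAll false g qs j ℤ.+ shift q h j
    ≡⟨ cong₂ ℤ._+_
         (mulAll-linear g qs j c (λ q∈ → ≤j (there q∈)) (λ q∈ q′∈ → j<+ (there q∈) (there q′∈)) (λ q∈ → g≡c (there q∈)))
         (trans (shift-≤ h q≤j) (trans (mulAll-< g (q ∷ qs) (j ∸ q) j∸q<) (g≡c (here refl)))) ⟩
  g j ℤ.+ ℤ.+ length qs ℤ.* c ℤ.+ c  ≡⟨ lem (g j) (ℤ.+ length qs) c ⟩
  g j ℤ.+ ℤ.+ length (q ∷ qs) ℤ.* c  ∎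
  where
  open ≡-Reasoning
  h = mulAll false g (q ∷ qs)
  q≤j = ≤j (here refl)
  j∸q< : ∀ {q′} → q′ ∈ q ∷ qs → j ∸ q < q′
  j∸q< {q′} q′∈ = subst (j ∸ q <_) (ℕ.m+n∸m≡n q q′) (ℕ.∸-monoˡ-< (j<+ (here refl) q′∈) q≤j)
  1≤q : 1 ≤ q
  1≤q = ℕ.≤-<-trans z≤n (j∸q< (here refl))
  lem : ∀ x n c → x ℤ.+ n ℤ.* c ℤ.+ c ≡ x ℤ.+ (ℤ.+ 1 ℤ.+ n) ℤ.* c
  lem = ℤ-solve-∀

-- Coefficients of (1 - x) / (1 - x^p)

[1-x]/[1-x^_] : ℕ → Series
[1-x]/[1-x^ p ] = mul (nfactor false p) (nfactor true 1)

module _ {p i : ℕ} (p∣i : p ∣ i) where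

  private
    u = nfactor false p

    u[1+i] : 2 ≤ p → u (1 + i) ≡ ℤ.+ 0
    u[1+i] 2≤p = nfactor-false-∤ λ p∣1+i →
      ℕ.<⇒≱ 2≤p (∣⇒≤ (∣m+n∣m⇒∣n (subst (p ∣_) (ℕ.+-comm 1 i) p∣1+i) p∣i))

    u[2+i] : 3 ≤ p → u (2 + i) ≡ ℤ.+ 0
    u[2+i] 3≤p = nfactor-false-∤ λ p∣2+i →
      ℕ.<⇒≱ 3≤p (∣⇒≤ (∣m+n∣m⇒∣n (subst (p ∣_) (ℕ.+-comm 2 i) p∣2+i) p∣i))

    coefficient : ∀ k → [1-x]/[1-x^ p ] k ≡ u k ℤ.- shift 1 u k
    coefficient k = trans (mul-comm u (nfactor true 1) k) (mul-nfactor-true 1 u k)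

  -- For p ≥ 2 the series is 1 - x + x^p - x^(p+1) + ..., so each coefficient is determined by the
  -- residue of its index modulo p. Residue 2 yields 0 only from p = 3 on.
  [1-x]/[1-x^p]-≡0 : 2 ≤ p → [1-x]/[1-x^ p ] i ≡ ℤ.+ 1
  [1-x]/[1-x^p]-≡0 2≤p = trans (coefficient i) (cong₂ ℤ._-_ (nfactor-false-∣ p∣i) (lem i p∣i))
    where
    lem : ∀ i → p ∣ i → shift 1 u i ≡ ℤ.+ 0
    lem zero _ = refl
    lem (suc i) p∣1+i = nfactor-false-∤ λ p∣i →
      ℕ.<⇒≱ 2≤p (∣⇒≤ (∣m+n∣m⇒∣n (subst (p ∣_) (ℕ.+-comm 1 i) p∣1+i) p∣i))

  [1-x]/[1-x^p]-≡1 : 2 ≤ p → [1-x]/[1-x^ p ] (1 + i) ≡ ℤ.-1ℤ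
  [1-x]/[1-x^p]-≡1 2≤p = trans (coefficient (1 + i)) (cong₂ ℤ._-_ (u[1+i] 2≤p) (nfactor-false-∣ p∣i))

  [1-x]/[1-x^p]-≡2 : 3 ≤ p → [1-x]/[1-x^ p ] (2 + i) ≡ ℤ.+ 0
  [1-x]/[1-x^p]-≡2 3≤p = trans (coefficient (2 + i)) (cong₂ ℤ._-_ (u[2+i] 3≤p) (u[1+i] (ℕ.<⇒≤ 3≤p)))

-- Unitary divisors

module _ {A : Set} (P : A → Bool) where

  ∈-bfilter⁺ : ∀ {x xs} → x ∈ xs → P x ≡ true → x ∈ bfilter P xs
  ∈-bfilter⁺ {xs = y ∷ ys} (here refl) Px rewrite Px = here refl
  ∈-bfilter⁺ {xs = y ∷ ys} (there x∈) Px with P y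
  ... | true = there (∈-bfilter⁺ x∈ Px)
  ... | false = ∈-bfilter⁺ x∈ Px

  ∈-bfilter⁻ : ∀ {x} xs → x ∈ bfilter P xs → x ∈ xs × P x ≡ true
  ∈-bfilter⁻ (y ∷ ys) x∈ with P y in Py
  ∈-bfilter⁻ (y ∷ ys) (here refl) | true = here refl , Py
  ∈-bfilter⁻ (y ∷ ys) (there x∈) | true with x∈ys , Px ← ∈-bfilter⁻ ys x∈ = there x∈ys , Px
  ∈-bfilter⁻ (y ∷ ys) x∈ | false with x∈ys , Px ← ∈-bfilter⁻ ys x∈ = there x∈ys , Px

  bfilter-! : ∀ {xs} → Unique xs → Unique (bfilter P xs)
  bfilter-! [] = []
  bfilter-! {x ∷ xs} (x∉ ∷ xs!) with P x
  ... | true = All.tabulate (λ y∈ → All.lookup x∉ (proj₁ (∈-bfilter⁻ xs y∈))) ∷ bfilter-! xs!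
  ... | false = bfilter-! xs!

unique∧set⇒↭ : ∀ {A : Set} {xs ys : List A} → Unique xs → Unique ys →
  (∀ {x} → x ∈ xs → x ∈ ys) → (∀ {x} → x ∈ ys → x ∈ xs) → xs ↭ ys
unique∧set⇒↭ xs! ys! to from = ∼bag⇒↭ (unique∧set⇒bag xs! ys! (mk⇔ to from))

∧-true : ∀ {a b} → a ∧ b ≡ true → a ≡ true × b ≡ true
∧-true {true} {true} refl = refl , refl

does-true : ∀ {P : Set} (P? : Dec P) → does P? ≡ true → P
does-true (yes p) _ = p

prime⇒coprime-∤ : ∀ {p d} → Prime p → ¬ p ∣ d → Coprime p d
prime⇒coprime-∤ pr p∤d (i∣p , i∣d) with prime⇒irreducible pr i∣p
... | inj₁ i≡1 = i≡1
... | inj₂ refl = contradiction i∣d p∤d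

coprime-*ˡ : ∀ {a b c} → Coprime a c → Coprime b c → Coprime (a * b) c
coprime-*ˡ a⊥c b⊥c (i∣ab , i∣c) =
  b⊥c (coprime-divisor (λ (k∣i , k∣a) → a⊥c (k∣a , ∣-trans k∣i i∣c)) i∣ab , i∣c)

coprime-^ˡ : ∀ {a c} e → Coprime a c → Coprime (a ^ e) c
coprime-^ˡ zero _ (i∣1 , _) = ∣1⇒≡1 i∣1
coprime-^ˡ (suc e) a⊥c = coprime-*ˡ a⊥c (coprime-^ˡ e a⊥c)

-- The witness c stands for n/d, so that no division occurs.
Unitary : ℕ → ℕ → Set
Unitary n d = ∃[ c ] n ≡ d * c × Coprime d c

∈-unitaryDivisors⁺ : ∀ {n d} → 1 ≤ n → Unitary n d → d ∈ unitaryDivisors n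
∈-unitaryDivisors⁺ {d = zero} () (c , refl , _)
∈-unitaryDivisors⁺ {n} {suc e} 1≤n (c , refl , d⊥c) =
  ∈-bfilter⁺ (isUnitary n)
    (∈-map⁺ suc (∈-upTo⁺ (∣⇒≤ {{>-nonZero 1≤n}} (m∣m*n c))))
    (cong₂ _∧_ (dec-true (suc e ∣? n) (m∣m*n c))
      (dec-true (gcd (suc e) (n / suc e) ≟ 1)
        (trans (cong (gcd (suc e)) (trans (cong (_/ suc e) (ℕ.*-comm (suc e) c)) (m*n/n≡m c (suc e)))) (coprime⇒gcd≡1 d⊥c))))

∈-unitaryDivisors⁻ : ∀ {n d} → d ∈ unitaryDivisors n → Unitary n d
∈-unitaryDivisors⁻ {n} {d} d∈
  with d∈′ , u ← ∈-bfilter⁻ (isUnitary n) (map suc (upTo n)) d∈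
  with e , _ , refl ← ∈-map⁻ suc d∈′
  with d∣n , d⊥ ← ∧-true u =
  n / suc e , sym (m*[n/m]≡n (does-true (suc e ∣? n) d∣n)) ,
  gcd≡1⇒coprime (does-true (gcd (suc e) (n / suc e) ≟ 1) d⊥)

unitaryDivisors-! : ∀ n → Unique (unitaryDivisors n)
unitaryDivisors-! n = bfilter-! (isUnitary n) (Unique.map⁺ ℕ.suc-injective (Unique.upTo⁺ n))

isPrimeDivisor : ℕ → ℕ → Bool
isPrimeDivisor n p = does (prime? p) ∧ does (p ∣? n)

primeDivisors : ℕ → List ℕ
primeDivisors n = bfilter (isPrimeDivisor n) (upTo (suc n))

∈-primeDivisors⁺ : ∀ {n p} → 1 ≤ n → Prime p → p ∣ n → p ∈ primeDivisors n
∈-primeDivisors⁺ {n} {p} 1≤n pr p∣n = ∈-bfilter⁺ (isPrimeDivisor n) (∈-upTo⁺ (s≤s (∣⇒≤ {{>-nonZero 1≤n}} p∣n)))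
  (cong₂ _∧_ (dec-true (prime? p) pr) (dec-true (p ∣? n) p∣n))

∈-primeDivisors⁻ : ∀ {n p} → p ∈ primeDivisors n → Prime p × p ∣ n
∈-primeDivisors⁻ {n} {p} p∈ with _ , u ← ∈-bfilter⁻ (isPrimeDivisor n) (upTo (suc n)) p∈
  with pr , p∣n ← ∧-true u = does-true (prime? p) pr , does-true (p ∣? n) p∣n

primeDivisors-! : ∀ n → Unique (primeDivisors n)
primeDivisors-! n = bfilter-! (isPrimeDivisor n) (Unique.upTo⁺ (suc n))

prime∣^ : ∀ {p r} e → Prime p → p ∣ r ^ e → p ∣ r
prime∣^ zero pr p∣1 with refl ← ∣1⇒≡1 p∣1 = contradiction pr ¬prime[1]
prime∣^ {p} {r} (suc e) pr p∣ with euclidsLemma r (r ^ e) pr p∣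
... | inj₁ p∣r = p∣r
... | inj₂ p∣r^e = prime∣^ e pr p∣r^e

prime∣prime : ∀ {p r} → Prime p → Prime r → p ∣ r → p ≡ r
prime∣prime pr pr′ p∣r with prime⇒irreducible pr′ p∣r
... | inj₁ refl = contradiction pr ¬prime[1]
... | inj₂ p≡r = p≡r

1≤* : ∀ {a b} → 1 ≤ a → 1 ≤ b → 1 ≤ a * b
1≤* = ℕ.*-mono-≤

module PrimePower {p : ℕ} (pr : Prime p) (e : ℕ) where

  private
    q = p ^ suc e

  p∣q : p ∣ q
  p∣q = m∣m*n (p ^ e)

  1≤q : 1 ≤ q
  1≤q = ℕ.m^n>0 p {{prime⇒nonZero pr}} (suc e)

  p≢1 : ¬ p ≡ 1
  p≢1 refl = ¬prime[1] pr

  q∣-cancel : ∀ {d c} → ¬ p ∣ d → q ∣ d * c → q ∣ c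
  q∣-cancel p∤d = coprime-divisor (coprime-^ˡ (suc e) (prime⇒coprime-∤ pr p∤d))

  module _ {a : ℕ} (1≤a : 1 ≤ a) (p∤a : ¬ p ∣ a) where

    private
      1≤qa = 1≤* 1≤q 1≤a
      instance
        q≢0 : NonZero q
        q≢0 = >-nonZero 1≤q

    unitary-*⁺ : ∀ {d} → Unitary a d → Unitary (q * a) d
    unitary-*⁺ {d} (c , refl , d⊥c) =
      q * c , lem ,
      Coprime.sym (coprime-*ˡ (coprime-^ˡ (suc e) (prime⇒coprime-∤ pr p∤d)) (Coprime.sym d⊥c))
      where
      p∤d : ¬ p ∣ d
      p∤d p∣d = p∤a (∣m⇒∣m*n c p∣d)
      lem : q * (d * c) ≡ d * (q * c)
      lem = trans (sym (ℕ.*-assoc q d c)) (trans (cong (_* c) (ℕ.*-comm q d)) (ℕ.*-assoc d q c))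

    unitary-*⁺′ : ∀ {d} → Unitary a d → Unitary (q * a) (q * d)
    unitary-*⁺′ {d} (c , refl , d⊥c) =
      c , sym (ℕ.*-assoc q d c) ,
      coprime-*ˡ (coprime-^ˡ (suc e) (prime⇒coprime-∤ pr λ p∣c → p∤a (∣n⇒∣m*n d p∣c))) d⊥c

    -- Coprimality of d and its cofactor c leaves p in at most one of them, so the whole power q
    -- goes to one side: into d if p ∣ d, into c otherwise.
    unitary-*⁻ : ∀ {d} → Unitary (q * a) d → Unitary a d ⊎ (∃[ d′ ] Unitary a d′ × d ≡ q * d′)
    unitary-*⁻ {d} (c , qa≡dc , d⊥c) with p ∣? d
    ... | yes p∣d with divides d′ refl ← q∣-cancel (λ p∣c → p≢1 (d⊥c (p∣d , p∣c))) (subst (q ∣_) (trans qa≡dc (ℕ.*-comm d c)) (m∣m*n a)) =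
      inj₂ (d′ , (c , a≡ , λ (i∣d′ , i∣c) → d⊥c (∣m⇒∣m*n q i∣d′ , i∣c)) , ℕ.*-comm d′ q)
      where
      a≡ : a ≡ d′ * c
      a≡ = ℕ.*-cancelˡ-≡ a (d′ * c) q (trans qa≡dc (trans (cong (_* c) (ℕ.*-comm d′ q)) (ℕ.*-assoc q d′ c)))
    ... | no p∤d with divides c′ refl ← q∣-cancel p∤d (subst (q ∣_) qa≡dc (m∣m*n a)) =
      inj₁ (c′ , a≡ , λ (i∣d , i∣c′) → d⊥c (i∣d , ∣m⇒∣m*n q i∣c′))
      where
      a≡ : a ≡ d * c′
      a≡ = ℕ.*-cancelˡ-≡ a (d * c′) q (trans qa≡dc (trans (sym (ℕ.*-assoc d c′ q)) (ℕ.*-comm (d * c′) q)))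

    -- Only a permutation, because `unitaryDivisors` lists by size while the right side lists the
    -- divisors without q before those with q. The two halves are disjoint because p ∤ a.
    unitaryDivisors-* : unitaryDivisors (q * a) ↭ unitaryDivisors a ++ map (q *_) (unitaryDivisors a)
    unitaryDivisors-* = unique∧set⇒↭ (unitaryDivisors-! (q * a))
      (Unique.++⁺ (unitaryDivisors-! a) (Unique.map⁺ (ℕ.*-cancelˡ-≡ _ _ q) (unitaryDivisors-! a)) disjoint) to from
      where
      disjoint : ∀ {d} → ¬ (d ∈ unitaryDivisors a × d ∈ map (q *_) (unitaryDivisors a))
      disjoint (d∈ , d∈′) with d′ , _ , refl ← ∈-map⁻ (q *_) d∈′ with c , a≡ , _ ← ∈-unitaryDivisors⁻ {a} d∈ =
        p∤a (∣-trans p∣q (m*n∣⇒m∣ q d′ (subst (q * d′ ∣_) (sym a≡) (m∣m*n c))))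
      to : ∀ {d} → d ∈ unitaryDivisors (q * a) → d ∈ unitaryDivisors a ++ map (q *_) (unitaryDivisors a)
      to d∈ with unitary-*⁻ (∈-unitaryDivisors⁻ {q * a} d∈)
      ... | inj₁ u = ∈-++⁺ˡ (∈-unitaryDivisors⁺ 1≤a u)
      ... | inj₂ (d′ , u , refl) = ∈-++⁺ʳ (unitaryDivisors a) (∈-map⁺ (q *_) (∈-unitaryDivisors⁺ 1≤a u))
      from : ∀ {d} → d ∈ unitaryDivisors a ++ map (q *_) (unitaryDivisors a) → d ∈ unitaryDivisors (q * a)
      from d∈ with ∈-++⁻ (unitaryDivisors a) d∈
      ... | inj₁ d∈a = ∈-unitaryDivisors⁺ 1≤qa (unitary-*⁺ (∈-unitaryDivisors⁻ {a} d∈a))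
      ... | inj₂ d∈qa with d′ , d′∈ , refl ← ∈-map⁻ (q *_) d∈qa =
        ∈-unitaryDivisors⁺ 1≤qa (unitary-*⁺′ (∈-unitaryDivisors⁻ {a} d′∈))

    primeDivisors-* : primeDivisors (q * a) ↭ p ∷ primeDivisors a
    primeDivisors-* = unique∧set⇒↭ (primeDivisors-! (q * a))
      (All.tabulate (λ { r∈ refl → p∤a (proj₂ (∈-primeDivisors⁻ {a} r∈)) }) ∷ primeDivisors-! a) to from
      where
      to : ∀ {r} → r ∈ primeDivisors (q * a) → r ∈ p ∷ primeDivisors a
      to r∈ with pr′ , r∣qa ← ∈-primeDivisors⁻ {q * a} r∈ with euclidsLemma q a pr′ r∣qa
      ... | inj₁ r∣q = here (prime∣prime pr′ pr (prime∣^ (suc e) pr′ r∣q))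
      ... | inj₂ r∣a = there (∈-primeDivisors⁺ 1≤a pr′ r∣a)
      from : ∀ {r} → r ∈ p ∷ primeDivisors a → r ∈ primeDivisors (q * a)
      from (here refl) = ∈-primeDivisors⁺ 1≤qa pr (∣m⇒∣m*n a p∣q)
      from (there r∈) with pr′ , r∣a ← ∈-primeDivisors⁻ {a} r∈ = ∈-primeDivisors⁺ 1≤qa pr′ (∣n⇒∣m*n q r∣a)

    μ*Pos-* : μ*Pos (q * a) ≡ not (μ*Pos a)
    μ*Pos-* = cong isEven (Perm.↭-length primeDivisors-*)

-- The product over the unitary divisors of a product of prime powers

divN-* : ∀ {d} c → 1 ≤ d → divN (d * c) d ≡ c
divN-* {suc e} c _ = trans (/-congˡ {o = suc e} (ℕ.*-comm (suc e) c)) (m*n/n≡m c (suc e))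

1≤unitary : ∀ {n d} → 1 ≤ n → Unitary n d → 1 ≤ d
1≤unitary {d = zero} () (c , refl , _)
1≤unitary {d = suc _} _ _ = s≤s z≤n

-- Factorisations into powers of distinct primes. The exponent `suc e` excludes the trivial power 1,
-- which would spoil the count of primes behind μ*.
data Canonical : List ℕ → Set where
  [] : Canonical []
  _^1+_∷⟨_,_⟩ : ∀ {qs} p e → Prime p → ¬ p ∣ product qs → Canonical qs → Canonical (p ^ suc e ∷ qs)

SignedDivisor = Bool × ℕ

-- All subproducts d of the list, each with the sign μ*(n/d): leaving out q puts one more prime into
-- n/d and flips the sign.
signedDivisors : List ℕ → List SignedDivisor
signedDivisors [] = (true , 1) ∷ []
signedDivisors (q ∷ qs) = map (map₁ not) (signedDivisors qs) ++ map (map₂ (q *_)) (signedDivisors qs)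

withSign : ℕ → ℕ → SignedDivisor
withSign n d = μ*Pos (divN n d) , d

canonical⇒1≤ : ∀ {qs} → Canonical qs → 1 ≤ product qs
canonical⇒1≤ [] = ℕ.≤-refl
canonical⇒1≤ ((p ^1+ e ∷⟨ pr , _ ⟩) cs) = 1≤* (PrimePower.1≤q pr e) (canonical⇒1≤ cs)

-- If c is the cofactor of d in a, then in q a the divisor d has cofactor q c, with one more prime,
-- while q d keeps the cofactor c.
map-withSign-↭ : ∀ {qs} → Canonical qs →
  map (withSign (product qs)) (unitaryDivisors (product qs)) ↭ signedDivisors qs
map-withSign-↭ [] = ↭-refl
map-withSign-↭ {q ∷ qs} ((p ^1+ e ∷⟨ pr , p∤a ⟩) cs) = begin
  map (withSign (q * a)) (unitaryDivisors (q * a))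
    ↭⟨ Perm.map⁺ (withSign (q * a)) (unitaryDivisors-* 1≤a p∤a) ⟩
  map (withSign (q * a)) (ds ++ map (q *_) ds)
    ≡⟨ map-++ (withSign (q * a)) ds (map (q *_) ds) ⟩
  map (withSign (q * a)) ds ++ map (withSign (q * a)) (map (q *_) ds)
    ≡⟨ cong₂ _++_
        (trans (map-cong-local (All.tabulate λ d∈ → sign-flip (∈-unitaryDivisors⁻ {a} d∈))) (map-∘ ds))
        (trans (sym (map-∘ ds)) (trans (map-cong-local (All.tabulate λ d∈ → sign-keep (∈-unitaryDivisors⁻ {a} d∈))) (map-∘ ds))) ⟩
  map (map₁ not) (map (withSign a) ds) ++ map (map₂ (q *_)) (map (withSign a) ds)
    ↭⟨ Perm.++⁺ (Perm.map⁺ (map₁ not) (map-withSign-↭ cs)) (Perm.map⁺ (map₂ (q *_)) (map-withSign-↭ cs)) ⟩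
  signedDivisors (q ∷ qs) ∎
  where
  open Perm.PermutationReasoning
  open PrimePower pr e
  a = product qs
  ds = unitaryDivisors a
  1≤a = canonical⇒1≤ cs
  sign-flip : ∀ {d} → Unitary a d → withSign (q * a) d ≡ map₁ not (withSign a d)
  sign-flip {d} u@(c , a≡dc , _) = cong (_, d) (≡.begin
    μ*Pos (divN (q * a) d)        ≡.≡⟨ cong (λ n → μ*Pos (divN (q * n) d)) a≡dc ⟩
    μ*Pos (divN (q * (d * c)) d)  ≡.≡⟨ cong (λ n → μ*Pos (divN n d)) (swap q d c) ⟩
    μ*Pos (divN (d * (q * c)) d)  ≡.≡⟨ cong μ*Pos (divN-* (q * c) 1≤d) ⟩
    μ*Pos (q * c)                 ≡.≡⟨ μ*Pos-* 1≤c (λ p∣c → p∤a (subst (p ∣_) (sym a≡dc) (∣n⇒∣m*n d p∣c))) ⟩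
    not (μ*Pos c)                 ≡.≡⟨ cong (not ∘ μ*Pos) (divN-* c 1≤d) ⟨
    not (μ*Pos (divN (d * c) d))  ≡.≡⟨ cong (λ n → not (μ*Pos (divN n d))) a≡dc ⟨
    not (μ*Pos (divN a d))        ≡.∎)
    where
    module ≡ = ≡-Reasoning
    1≤d = 1≤unitary 1≤a u
    1≤c : 1 ≤ c
    1≤c = ℕ.n≢0⇒n>0 λ { refl → ℕ.<⇒≢ 1≤a (sym (trans a≡dc (ℕ.*-zeroʳ d))) }
    swap : ∀ q d c → q * (d * c) ≡ d * (q * c)
    swap q d c = trans (sym (ℕ.*-assoc q d c)) (trans (cong (_* c) (ℕ.*-comm q d)) (ℕ.*-assoc d q c))
  sign-keep : ∀ {d} → Unitary a d → withSign (q * a) (q * d) ≡ map₂ (q *_) (withSign a d)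
  sign-keep {d} u@(c , a≡dc , _) = cong (λ n → μ*Pos n , q * d) (≡.begin
    divN (q * a) (q * d)        ≡.≡⟨ cong (λ n → divN (q * n) (q * d)) a≡dc ⟩
    divN (q * (d * c)) (q * d)  ≡.≡⟨ cong (λ n → divN n (q * d)) (ℕ.*-assoc q d c) ⟨
    divN (q * d * c) (q * d)    ≡.≡⟨ divN-* c (1≤* 1≤q 1≤d) ⟩
    c                           ≡.≡⟨ divN-* c 1≤d ⟨
    divN (d * c) d              ≡.≡⟨ cong (λ n → divN n d) a≡dc ⟨
    divN a d                    ≡.∎)
    where
    module ≡ = ≡-Reasoning
    1≤d = 1≤unitary 1≤a u

-- Treats Φ* (`true`) and the reciprocal product inside Ψ* (`false`) together. It reduces on both
-- constants, so the products in `Φ*` and `Ψ*` are instances by definition.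
twist : Bool → Bool → Bool
twist b s = if b then s else not s

twist-notʳ : ∀ b s → twist b (not s) ≡ not (twist b s)
twist-notʳ true s = refl
twist-notʳ false s = refl

twist-notˡ : ∀ b s → twist (not b) s ≡ not (twist b s)
twist-notˡ true s = refl
twist-notˡ false s = sym (not-involutive s)

prod : (Bool → ℕ → Series) → Bool → List SignedDivisor → Series
prod φ b = foldr (λ (s , d) → mul (φ (twist b s) d)) one

signIf : Bool → ℤ → ℤ
signIf b z = if b then z else ℤ.- z

-- Each factor (x^d - 1)^{±1} is minus (1 - x^d)^{±1}, so only the parity of the number of factors
-- matters.
prod-factor : ∀ b ds j → prod factor b ds j ≡ signIf (isEven (length ds)) (prod nfactor b ds j)
prod-factor b [] j = refl
prod-factor b ((s , d) ∷ ds) j = begin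
  mul f (prod factor b ds) j       ≡⟨ conv-cong j j (λ _ _ → refl) (λ k _ → prod-factor b ds k) ℕ.≤-refl ⟩
  mul f (λ k → signIf e (g k)) j   ≡⟨ lem e ⟩
  signIf (not e) (mul (neg f) g j) ∎
  where
  open ≡-Reasoning
  e = isEven (length ds)
  f = factor (twist b s) d
  g = prod nfactor b ds
  lem : ∀ e → mul f (λ k → signIf e (g k)) j ≡ signIf (not e) (mul (neg f) g j)
  lem true = sym (trans (cong ℤ.-_ (mul-negˡ f g j)) (ℤ.neg-involutive (mul f g j)))
  lem false = trans (mul-negʳ f g j) (sym (mul-negˡ f g j))

isEven-double : ∀ n → isEven (n + n) ≡ true
isEven-double zero = refl
isEven-double (suc n) = trans (cong (not ∘ isEven) (ℕ.+-suc n n)) (trans (not-involutive (isEven (n + n))) (isEven-double n))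

-- Each prime power doubles the number of divisors. The empty list is excluded: its single divisor 1
-- would leave a minus sign.
signedDivisors-even : ∀ q qs → isEven (length (signedDivisors (q ∷ qs))) ≡ true
signedDivisors-even q qs = trans
  (cong isEven (trans (length-++ (map (map₁ not) ds)) (cong₂ _+_ (length-map _ ds) (length-map _ ds))))
  (isEven-double (length ds))
  where ds = signedDivisors qs

-- The head is the divisor 1, whose complement contains all of `qs`. Every other subproduct contains
-- some element of `qs` and is therefore at least as large as it.
signedDivisors-split : ∀ {qs} → (∀ {q} → q ∈ qs → 1 ≤ q) → ∃[ ds ]
  signedDivisors qs ≡ (isEven (length qs) , 1) ∷ ds × All (λ (_ , d) → Any (_≤ d) qs) ds
signedDivisors-split {[]} _ = [] , refl , []
signedDivisors-split {q ∷ qs} 1≤ with ds , eq , ≤ds ← signedDivisors-split {qs} (1≤ ∘ there) rewrite eq =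
  map (map₁ not) ds ++ (isEven (length qs) , q * 1) ∷ map (map₂ (q *_)) ds , refl ,
  All.++⁺ (All.map⁺ (All.map there ≤ds))
    (here (ℕ.≤-reflexive (sym (ℕ.*-identityʳ q))) ∷
     All.map⁺ (All.map (λ {(_ , d)} q′≤d → there (Any.map (λ q′≤ → ℕ.≤-trans q′≤ (ℕ.m≤n*m d q {{>-nonZero (1≤ (here refl))}})) q′≤d)) ≤ds))

module _ (J : ℕ) where

  open CommutativeMonoid (mul-monoid J) using (setoid; ∙-cong; ∙-congˡ; ∙-congʳ; identityʳ; identityˡ; comm)
    renaming (refl to ≈-refl; sym to ≈-sym; trans to ≈-trans; assoc to ∙-assoc)
  open SetoidReasoning setoid

  prod-++ : ∀ φ b ds es → prod φ b (ds ++ es) ≈[ J ] mul (prod φ b ds) (prod φ b es)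
  prod-++ φ b [] es = ≈-sym (identityˡ _)
  prod-++ φ b ((s , d) ∷ ds) es = ≈-trans (∙-congˡ (prod-++ φ b ds es)) (≈-sym (∙-assoc _ _ _))

  prod-↭ : ∀ φ b {ds es} → ds ↭ es → prod φ b ds ≈[ J ] prod φ b es
  prod-↭ φ b Perm.refl = ≈-refl
  prod-↭ φ b (Perm.prep _ p) = ∙-congˡ (prod-↭ φ b p)
  prod-↭ φ b (Perm.swap _ _ p) =
    ≈-trans (≈-sym (∙-assoc _ _ _)) (≈-trans (∙-cong (comm _ _) (prod-↭ φ b p)) (∙-assoc _ _ _))
  prod-↭ φ b (Perm.trans p p′) = ≈-trans (prod-↭ φ b p) (prod-↭ φ b p′)

  prod-flip : ∀ b ds → prod nfactor b (map (map₁ not) ds) ≈[ J ] prod nfactor (not b) ds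
  prod-flip b [] = ≈-refl
  prod-flip b ((s , d) ∷ ds) rewrite twist-notʳ b s | twist-notˡ b s = ∙-congˡ (prod-flip b ds)

  prod-> : ∀ b {ds} → All (λ (_ , d) → J < d) ds → prod nfactor b ds ≈[ J ] one
  prod-> b [] = ≈-refl
  prod-> b {(s , d) ∷ ds} (J<d ∷ J<ds) = ≈-trans (∙-cong (nfactor-> (twist b s) J<d) (prod-> b J<ds)) (identityˡ one)

  -- Induction on the list. The divisors without q repeat the product for the rest with all
  -- exponents flipped. Among those with q only q itself can be at most J, since any other is at
  -- least some q q′ > J. The complement of q has one prime fewer than that of 1, so 1 - x^q gets
  -- the exponent opposite to that of 1 - x.
  prod-signedDivisors : ∀ b {qs} → (∀ {q} → q ∈ qs → 1 ≤ q) → AllPairs (λ q q′ → J < q * q′) qs →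
    let σ = twist b (isEven (length qs)) in
    prod nfactor b (signedDivisors qs) ≈[ J ] mulAll (not σ) (nfactor σ 1) qs
  prod-signedDivisors b {[]} _ _ = identityʳ _
  prod-signedDivisors b {q ∷ qs} 1≤ (J<q ∷ J<) = begin
    prod nfactor b (signedDivisors (q ∷ qs))
      ≈⟨ prod-++ nfactor b (map (map₁ not) ds) (map (map₂ (q *_)) ds) ⟩
    mul (prod nfactor b (map (map₁ not) ds)) (prod nfactor b (map (map₂ (q *_)) ds))
      ≈⟨ comm _ _ ⟩
    mul (prod nfactor b (map (map₂ (q *_)) ds)) (prod nfactor b (map (map₁ not) ds))
      ≈⟨ ∙-cong scaled (≈-trans (prod-flip b ds) (prod-signedDivisors (not b) (1≤ ∘ there) J<)) ⟩
    mul (nfactor σ q) (mulAll (not (twist (not b) e)) (nfactor (twist (not b) e) 1) qs)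
      ≡⟨ cong₂ (λ τ τ′ → mul (nfactor τ q) (mulAll (not τ′) (nfactor τ′ 1) qs)) σ≡ (trans (twist-notˡ b e) (sym (twist-notʳ b e))) ⟩
    mulAll (not σ′) (nfactor σ′ 1) (q ∷ qs) ∎
    where
    ds = signedDivisors qs
    e = isEven (length qs)
    σ = twist b e
    σ′ = twist b (not e)
    σ≡ : σ ≡ not σ′
    σ≡ = sym (trans (cong not (twist-notʳ b e)) (not-involutive σ))
    big : ∀ {d} → Any (_≤ d) qs → J < q * d
    big q′≤d with q′ , q′∈ , q′≤ ← find q′≤d = ℕ.<-≤-trans (All.lookup J<q q′∈) (ℕ.*-monoʳ-≤ q q′≤)
    scaled : prod nfactor b (map (map₂ (q *_)) ds) ≈[ J ] nfactor σ q
    scaled with es , eq , ≤es ← signedDivisors-split {qs} (1≤ ∘ there) rewrite eq = begin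
      mul (nfactor σ (q * 1)) (prod nfactor b (map (map₂ (q *_)) es))
        ≈⟨ ∙-congˡ (prod-> b (All.map⁺ (All.map big ≤es))) ⟩
      mul (nfactor σ (q * 1)) one
        ≈⟨ identityʳ _ ⟩
      nfactor σ (q * 1)
        ≡⟨ cong (nfactor σ) (ℕ.*-identityʳ q) ⟩
      nfactor σ q ∎

  prod-unitaryDivisors : ∀ b {q qs} → Canonical (q ∷ qs) → AllPairs (λ q q′ → J < q * q′) (q ∷ qs) →
    let n = product (q ∷ qs); σ = twist b (isEven (length (q ∷ qs))) in
    foldr (λ d → mul (factor (twist b (μ*Pos (divN n d))) d)) one (unitaryDivisors n)
      ≈[ J ] mulAll (not σ) (nfactor σ 1) (q ∷ qs)
  prod-unitaryDivisors b {q} {qs} cs J< = begin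
    foldr (λ d → mul (factor (twist b (μ*Pos (divN n d))) d)) one (unitaryDivisors n)
      ≡⟨ foldr-map (λ (s , d) → mul (factor (twist b s) d)) (withSign n) one (unitaryDivisors n) ⟨
    prod factor b (map (withSign n) (unitaryDivisors n))
      ≈⟨ prod-↭ factor b (map-withSign-↭ cs) ⟩
    prod factor b ds
      ≈⟨ (λ j _ → trans (prod-factor b ds j) (cong (λ e → signIf e (prod nfactor b ds j)) (signedDivisors-even q qs))) ⟩
    prod nfactor b ds
      ≈⟨ prod-signedDivisors b (canonical⇒1≤q cs) J< ⟩
    mulAll (not σ) (nfactor σ 1) (q ∷ qs) ∎
    where
    n = product (q ∷ qs)
    σ = twist b (isEven (length (q ∷ qs)))
    ds = signedDivisors (q ∷ qs)
    canonical⇒1≤q : ∀ {qs} → Canonical qs → ∀ {q} → q ∈ qs → 1 ≤ q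
    canonical⇒1≤q ((p ^1+ e ∷⟨ pr , _ ⟩) _) (here refl) = PrimePower.1≤q pr e
    canonical⇒1≤q ((p ^1+ e ∷⟨ pr , _ ⟩) cs) (there q∈) = canonical⇒1≤q cs q∈

-- Prime powers of nearly equal size

prime-divisor : ∀ {n} → 2 ≤ n → ∃[ p ] Prime p × p ∣ n
prime-divisor {n} 2≤n with factorise n {{>-nonZero (ℕ.<⇒≤ 2≤n)}}
... | record { factors = [] ; isFactorisation = refl } = contradiction 2≤n (ℕ.<-irrefl refl)
... | record { factors = p ∷ ps ; isFactorisation = n≡ ; factorsPrime = pr ∷ _ } =
  p , pr , subst (p ∣_) (sym n≡) (m∣m*n (product ps))

n∣n! : ∀ n .{{_ : NonZero n}} → n ∣ n !
n∣n! (suc n) = m∣m*n (n !)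

abstract
  -- Euclid: a prime divisor of n! + 1 cannot be at most n.
  prime-above : ∀ n → ∃[ p ] Prime p × n < p
  prime-above n with p , pr , p∣ ← prime-divisor (s≤s (ℕ.1≤n! n)) with p ≤? n
  ... | no p≰n = p , pr , ℕ.≰⇒> p≰n
  ... | yes p≤n with refl ← ∣1⇒≡1 (∣m+n∣m⇒∣n (subst (p ∣_) (ℕ.+-comm 1 (n !)) p∣) (∣-trans (n∣n! p {{prime⇒nonZero pr}}) (m≤n⇒m!∣n! p≤n))) =
    contradiction pr ¬prime[1]

primes>_ : ℕ → ℕ → ℕ
(primes> n) zero = proj₁ (prime-above n)
(primes> n) (suc i) = proj₁ (prime-above ((primes> n) i))

primes>-prime : ∀ n i → Prime ((primes> n) i)
primes>-prime n zero = proj₁ (proj₂ (prime-above n))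
primes>-prime n (suc i) = proj₁ (proj₂ (prime-above ((primes> n) i)))

primes>-step : ∀ n i → (primes> n) i < (primes> n) (suc i)
primes>-step n i = proj₂ (proj₂ (prime-above ((primes> n) i)))

primes>-mono : ∀ n {i j} → i < j → (primes> n) i < (primes> n) j
primes>-mono n {i} {suc j} (s≤s i≤j) with ℕ.m≤n⇒m<n∨m≡n i≤j
... | inj₁ i<j = ℕ.<-trans (primes>-mono n i<j) (primes>-step n j)
... | inj₂ refl = primes>-step n j

primes>-> : ∀ n i → n < (primes> n) i
primes>-> n zero = proj₂ (proj₂ (prime-above n))
primes>-> n (suc i) = ℕ.<-trans (primes>-> n i) (primes>-step n i)

module _ (p : ℕ) (2≤p : 2 ≤ p) where

  -- The exponent is kept while p^a still reaches 2^(n+1) and is otherwise raised by one, which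
  -- makes its monotonicity in n immediate.
  power-above : ∀ n → ∃[ a ] 2 ^ n ≤ p ^ a × p ^ a < p * 2 ^ n
  power-above zero = 0 , ℕ.≤-refl , subst (1 <_) (sym (ℕ.*-identityʳ p)) 2≤p
  power-above (suc n) with a , lo , hi ← power-above n with 2 ^ suc n ≤? p ^ a
  ... | yes 2^≤ = a , 2^≤ , ℕ.<-≤-trans hi (ℕ.*-monoʳ-≤ p (ℕ.m≤n*m (2 ^ n) 2))
  ... | no 2^≰ = suc a , ℕ.*-mono-≤ 2≤p lo , ℕ.*-monoʳ-< p {{>-nonZero (ℕ.<⇒≤ 2≤p)}} (ℕ.≰⇒> 2^≰)

  exponent : ℕ → ℕ
  exponent n = proj₁ (power-above n)

  exponent-step : ∀ n → exponent n ≤ exponent (suc n)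
  exponent-step n with a , lo , hi ← power-above n with 2 ^ suc n ≤? p ^ a
  ... | yes _ = ℕ.≤-refl
  ... | no _ = ℕ.n≤1+n a

  exponent-mono : ∀ {m n} → m ≤ n → exponent m ≤ exponent n
  exponent-mono {m} {n} m≤n with ℕ.m≤n⇒m<n∨m≡n m≤n
  exponent-mono {m} {suc n} _ | inj₁ (s≤s m≤n) = ℕ.≤-trans (exponent-mono m≤n) (exponent-step n)
  ... | inj₂ refl = ℕ.≤-refl

-- The t values at n are coded as one element of `Fin (K ^ t)`, so two of the first K^t + 1
-- arguments share their code.
pigeonhole-family : ∀ {t K} (f : Fin t → ℕ → Fin K) → ∃[ m ] ∃[ n ] m < n × (∀ i → f i m ≡ f i n)
pigeonhole-family {t} {K} f
  with i , j , i<j , eq ← Fin.pigeonhole (ℕ.n<1+n (K ^ t)) (λ n → funToFin (λ i → f i (toℕ n))) =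
  toℕ i , toℕ j , i<j , λ k → trans (sym (Fin.finToFun-funToFin _ k))
    (trans (cong (λ x → finToFun x k) eq) (Fin.finToFun-funToFin _ k))

-- u is the common leading part ⌊3A/Z⌋ = ⌊3Aq/ZY⌋.
ratio-bounds : ∀ {A Z q Y u} → .{{_ : NonZero q}} → 3 ≤ u → u * Z ≤ 3 * A → 3 * A < suc u * Z →
  u * (Z * Y) ≤ 3 * (A * q) → 3 * (A * q) < suc u * (Z * Y) → 3 * Y < 4 * q × 3 * q < 4 * Y
ratio-bounds {A} {Z} {q} {Y} {u} 3≤u lo hi lo′ hi′ = bound {Y} {q} uY< , bound {q} {Y} uq<
  where
  open ℕ.≤-Reasoning
  -- A common leading part fixes a ratio up to the factor (u + 1) / u, which is at most 4/3 because
  -- u ≥ 3.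
  bound : ∀ {x y} → u * x < suc u * y → 3 * x < 4 * y
  bound {x} {y} u< = ℕ.*-cancelˡ-< u (3 * x) (4 * y) (begin-strict
    u * (3 * x)       ≡⟨ lem₁ u x ⟩
    3 * (u * x)       <⟨ ℕ.*-monoʳ-< 3 u< ⟩
    3 * (suc u * y)   ≡⟨ lem₂ u y ⟩
    (3 + 3 * u) * y   ≤⟨ ℕ.*-monoˡ-≤ y (ℕ.+-monoˡ-≤ (3 * u) 3≤u) ⟩
    (u + 3 * u) * y   ≡⟨ lem₃ u y ⟩
    u * (4 * y)       ∎)
    where
    lem₁ : ∀ u x → u * (3 * x) ≡ 3 * (u * x)
    lem₁ = ℕ-solve-∀
    lem₂ : ∀ u y → 3 * (suc u * y) ≡ (3 + 3 * u) * y
    lem₂ = ℕ-solve-∀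
    lem₃ : ∀ u y → (u + 3 * u) * y ≡ u * (4 * y)
    lem₃ = ℕ-solve-∀
  uq< : u * q < suc u * Y
  uq< = ℕ.*-cancelˡ-< Z _ _ (begin-strict
    Z * (u * q)      ≡⟨ lem₁ Z u q ⟩
    u * Z * q        ≤⟨ ℕ.*-monoˡ-≤ q lo ⟩
    3 * A * q        ≡⟨ ℕ.*-assoc 3 A q ⟩
    3 * (A * q)      <⟨ hi′ ⟩
    suc u * (Z * Y)  ≡⟨ lem₂ (suc u) Z Y ⟩
    Z * (suc u * Y)  ∎)
    where
    lem₁ : ∀ Z u q → Z * (u * q) ≡ u * Z * q
    lem₁ = ℕ-solve-∀
    lem₂ : ∀ u Z Y → u * (Z * Y) ≡ Z * (u * Y)
    lem₂ = ℕ-solve-∀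
  uY< : u * Y < suc u * q
  uY< = ℕ.*-cancelˡ-< Z _ _ (begin-strict
    Z * (u * Y)      ≡⟨ lem₂ u Z Y ⟨
    u * (Z * Y)      ≤⟨ lo′ ⟩
    3 * (A * q)      ≡⟨ ℕ.*-assoc 3 A q ⟨
    3 * A * q        <⟨ ℕ.*-monoˡ-< q hi ⟩
    suc u * Z * q    ≡⟨ lem₁ Z (suc u) q ⟨
    Z * (suc u * q)  ∎)
    where
    lem₁ : ∀ Z u q → Z * (u * q) ≡ u * Z * q
    lem₁ = ℕ-solve-∀
    lem₂ : ∀ u Z Y → u * (Z * Y) ≡ Z * (u * Y)
    lem₂ = ℕ-solve-∀

%-≡⇒∣∸ : ∀ {a b r} .{{_ : NonZero r}} → a % r ≡ b % r → r ∣ b ∸ a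
%-≡⇒∣∸ {a} {b} {r} eq = divides (b / r ∸ a / r) (begin
  b ∸ a                                          ≡⟨ cong₂ _∸_ (m≡m%n+[m/n]*n b r) (m≡m%n+[m/n]*n a r) ⟩
  b % r + b / r * r ∸ (a % r + a / r * r)        ≡⟨ cong (λ x → b % r + b / r * r ∸ (x + a / r * r)) eq ⟩
  b % r + b / r * r ∸ (b % r + a / r * r)        ≡⟨ ℕ.[m+n]∸[m+o]≡n∸o (b % r) _ _ ⟩
  b / r * r ∸ a / r * r                          ≡⟨ ℕ.*-distribʳ-∸ r (b / r) (a / r) ⟨
  (b / r ∸ a / r) * r                            ∎)
  where open ≡-Reasoning

m<[1+m/n]*n : ∀ m n .{{_ : NonZero n}} → m < suc (m / n) * n
m<[1+m/n]*n m n = subst (_< suc (m / n) * n) (sym (m≡m%n+[m/n]*n m n)) (ℕ.+-monoˡ-< (m / n * n) (m%n<n m n))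

-- The leading part of a at scale 2^n. The factor 3 makes it at least 3 as soon as 2^n ≤ a, and
-- hence precise enough for `ratio-bounds`.
⌊3_/2^_⌋ : ℕ → ℕ → ℕ
⌊3 a /2^ n ⌋ = _/_ (3 * a) (2 ^ n) {{ℕ.m^n≢0 2 n}}

⌊3a/2^n⌋*2^n≤3a : ∀ a n → ⌊3 a /2^ n ⌋ * 2 ^ n ≤ 3 * a
⌊3a/2^n⌋*2^n≤3a a n = m/n*n≤m (3 * a) (2 ^ n) {{ℕ.m^n≢0 2 n}}

3a<[1+⌊3a/2^n⌋]*2^n : ∀ a n → 3 * a < suc ⌊3 a /2^ n ⌋ * 2 ^ n
3a<[1+⌊3a/2^n⌋]*2^n a n = m<[1+m/n]*n (3 * a) (2 ^ n) {{ℕ.m^n≢0 2 n}}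

3≤⌊3a/2^n⌋ : ∀ {a n} → 2 ^ n ≤ a → 3 ≤ ⌊3 a /2^ n ⌋
3≤⌊3a/2^n⌋ {a} {n} 2^n≤a = ℕ.≤-trans (ℕ.≤-reflexive (sym (m*n/n≡m 3 (2 ^ n)))) (/-monoˡ-≤ (2 ^ n) (ℕ.*-monoʳ-≤ 3 2^n≤a))
  where
  instance
    2^n≢0 : NonZero (2 ^ n)
    2^n≢0 = ℕ.m^n≢0 2 n

⌊3a/2^n⌋<3c : ∀ {a n c} → a < c * 2 ^ n → ⌊3 a /2^ n ⌋ < 3 * c
⌊3a/2^n⌋<3c {a} {n} {c} a< = m<n*o⇒m/o<n {{ℕ.m^n≢0 2 n}} (ℕ.<-≤-trans (ℕ.*-monoʳ-< 3 a<) (ℕ.≤-reflexive (sym (ℕ.*-assoc 3 c (2 ^ n)))))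

-- Recording, for each n, the leading part and the residue modulo r of the power of p i next above 2^n,
-- two values m < n with equal records yield exponents for which the quotients of the powers are all close to 2^(n-m).
abstract
  close-powers : ∀ {t} (p : Fin t → ℕ) C r .{{_ : NonZero r}} →
    (∀ i → 2 ≤ p i) → (∀ i → p i ≤ C) → (∀ i → Coprime (p i) r) →
    ∃[ Y ] 2 ≤ Y × (Σ[ e ∈ (Fin t → ℕ) ] ∀ i → let q = p i ^ suc (e i) in
      3 * Y < 4 * q × 3 * q < 4 * Y × r ∣ q ∸ 1)
  close-powers {t} p C r 2≤p p≤C p⊥r = collect (pigeonhole-family record-at)
    where
    a : Fin t → ℕ → ℕ
    a i = exponent (p i) (2≤p i)

    A : Fin t → ℕ → ℕ
    A i n = p i ^ a i n

    u : Fin t → ℕ → ℕ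
    u i n = ⌊3 A i n /2^ n ⌋

    u< : ∀ i n → u i n < 3 * C
    u< i n = ⌊3a/2^n⌋<3c {A i n} {n} {C} (ℕ.<-≤-trans (proj₂ (proj₂ (power-above (p i) (2≤p i) n))) (ℕ.*-monoˡ-≤ (2 ^ n) (p≤C i)))

    record-at : Fin t → ℕ → Fin (3 * C * r)
    record-at i n = combine (fromℕ< (u< i n)) (fromℕ< (m%n<n (A i n) r))

    3≤u : ∀ i n → 3 ≤ u i n
    3≤u i n = 3≤⌊3a/2^n⌋ {A i n} {n} (proj₁ (proj₂ (power-above (p i) (2≤p i) n)))

    collect : (∃[ m ] ∃[ n ] m < n × (∀ i → record-at i m ≡ record-at i n)) →
      ∃[ Y ] 2 ≤ Y × (Σ[ e ∈ (Fin t → ℕ) ] ∀ i → let q = p i ^ suc (e i) in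
        3 * Y < 4 * q × 3 * q < 4 * Y × r ∣ q ∸ 1)
    collect (m , n , m<n , same) = Y , 2≤Y , (λ i → pred (b i)) , λ i → subst (Good i) (sym (suc-pred-b i)) (good i)
      where
      Y : ℕ
      Y = 2 ^ (n ∸ m)
      2≤Y : 2 ≤ Y
      2≤Y = ℕ.^-monoʳ-≤ 2 (ℕ.m<n⇒0<n∸m m<n)

      b : Fin t → ℕ
      b i = a i n ∸ a i m

      Good : Fin t → ℕ → Set
      Good i e = 3 * Y < 4 * p i ^ e × 3 * p i ^ e < 4 * Y × r ∣ p i ^ e ∸ 1

      2^n≡ : 2 ^ n ≡ 2 ^ m * Y
      2^n≡ = trans (cong (2 ^_) (sym (ℕ.m+[n∸m]≡n (ℕ.<⇒≤ m<n)))) (ℕ.^-distribˡ-+-* 2 m (n ∸ m))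

      A≡ : ∀ i → A i n ≡ A i m * p i ^ b i
      A≡ i = trans (cong (p i ^_) (sym (ℕ.m+[n∸m]≡n (exponent-mono (p i) (2≤p i) (ℕ.<⇒≤ m<n))))) (ℕ.^-distribˡ-+-* (p i) (a i m) (b i))

      u≡ : ∀ i → u i m ≡ u i n
      u≡ i = Fin.fromℕ<-injective _ _ (u< i m) (u< i n) (Fin.combine-injectiveˡ _ _ _ _ (same i))

      A%≡ : ∀ i → A i m % r ≡ A i n % r
      A%≡ i = Fin.fromℕ<-injective _ _ (m%n<n (A i m) r) (m%n<n (A i n) r)
        (Fin.combine-injectiveʳ (fromℕ< (u< i m)) _ (fromℕ< (u< i n)) _ (same i))

      good : ∀ i → Good i (b i)
      good i = proj₁ bounds , proj₂ bounds ,
        -- Equal residues give r ∣ A_n - A_m = A_m (q - 1), and A_m is coprime to r.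
        coprime-divisor (Coprime.sym (coprime-^ˡ (a i m) (p⊥r i))) (subst (r ∣_) eq (%-≡⇒∣∸ (A%≡ i)))
        where
        q : ℕ
        q = p i ^ b i
        bounds : 3 * Y < 4 * q × 3 * q < 4 * Y
        bounds = ratio-bounds {A i m} {2 ^ m} {{ℕ.m^n≢0 (p i) (b i) {{>-nonZero (ℕ.<⇒≤ (2≤p i))}}}} (3≤u i m)
          (⌊3a/2^n⌋*2^n≤3a (A i m) m) (3a<[1+⌊3a/2^n⌋]*2^n (A i m) m)
          (subst₂ _≤_ (cong₂ _*_ (sym (u≡ i)) 2^n≡) (cong (3 *_) (A≡ i)) (⌊3a/2^n⌋*2^n≤3a (A i n) n))
          (subst₂ _<_ (cong (3 *_) (A≡ i)) (cong₂ (λ x y → suc x * y) (sym (u≡ i)) 2^n≡) (3a<[1+⌊3a/2^n⌋]*2^n (A i n) n))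
        eq : A i n ∸ A i m ≡ A i m * (q ∸ 1)
        eq = trans (cong₂ _∸_ (A≡ i) (sym (ℕ.*-identityʳ (A i m)))) (sym (ℕ.*-distribˡ-∸ (A i m) q 1))

      -- Exponent 0 would mean q = 1, but 3Y < 4 is impossible for Y ≥ 2.
      b≢0 : ∀ i → b i ≢ 0
      b≢0 i b≡0 with lo , _ ← subst (Good i) b≡0 (good i) = ℕ.<⇒≱ lo (ℕ.≤-trans (s≤s (s≤s (s≤s (s≤s z≤n)))) (ℕ.*-monoʳ-≤ 3 2≤Y))

      suc-pred-b : ∀ i → suc (pred (b i)) ≡ b i
      suc-pred-b i = ℕ.suc-pred (b i) {{≢-nonZero (b≢0 i)}}

-- Assembling n

prime⇒2≤ : ∀ {p} → Prime p → 2 ≤ p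
prime⇒2≤ pr = nonTrivial⇒n>1 _ {{prime⇒nonTrivial pr}}

remove-prime : ∀ {p} → Prime p → ∀ m → 1 ≤ m → ∃[ v ] ∃[ m′ ] m ≡ p ^ v * m′ × ¬ p ∣ m′
remove-prime {p} pr = <-rec _ step
  where
  step : ∀ m → (∀ {k} → k < m → 1 ≤ k → ∃[ v ] ∃[ m′ ] k ≡ p ^ v * m′ × ¬ p ∣ m′) →
    1 ≤ m → ∃[ v ] ∃[ m′ ] m ≡ p ^ v * m′ × ¬ p ∣ m′
  step m rec 1≤m with p ∣? m
  ... | no p∤m = 0 , m , sym (ℕ.*-identityˡ m) , p∤m
  ... | yes p∣m with v , m′ , k≡ , p∤m′ ← rec (quotient-< p∣m {{prime⇒nonTrivial pr}} {{>-nonZero 1≤m}})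
                     (>-nonZero⁻¹ _ {{quotient≢0 p∣m {{>-nonZero 1≤m}}}}) =
    suc v , m′ , trans (m∣n⇒n≡m*quotient p∣m) (trans (cong (p *_) k≡) (sym (ℕ.*-assoc p (p ^ v) m′))) , p∤m′

n<m^n : ∀ {m} → 2 ≤ m → ∀ n → n < m ^ n
n<m^n 2≤m zero = s≤s z≤n
n<m^n {m} 2≤m (suc n) = begin-strict
  suc n          ≤⟨ n<m^n 2≤m n ⟩
  m ^ n          <⟨ ℕ.m<m+n (m ^ n) (ℕ.≤-<-trans z≤n (n<m^n 2≤m n)) ⟩
  m ^ n + m ^ n  ≡⟨ cong (m ^ n +_) (ℕ.+-identityʳ (m ^ n)) ⟨
  2 * m ^ n      ≤⟨ ℕ.*-monoˡ-≤ (m ^ n) 2≤m ⟩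
  m * m ^ n      ∎
  where open ℕ.≤-Reasoning

∤⇒1≤ : ∀ {d n} → ¬ d ∣ n → 1 ≤ n
∤⇒1≤ {d} d∤n = ℕ.n≢0⇒n>0 λ { refl → d∤n (d ∣0) }

cofactor-< : ∀ {p} → Prime p → ∀ v {m} → ¬ p ∣ m → m < p ^ suc v * m
cofactor-< {p} pr v {m} p∤m = subst (m <_) (ℕ.*-comm m (p ^ suc v)) (ℕ.m<m*n m (p ^ suc v) {{>-nonZero (∤⇒1≤ p∤m)}}
  (ℕ.<-≤-trans (prime⇒2≤ pr) (∣⇒≤ {{>-nonZero (PrimePower.1≤q pr v)}} (PrimePower.p∣q pr v))))

^-distribʳ-* : ∀ n a b → (a * b) ^ n ≡ a ^ n * b ^ n
^-distribʳ-* zero a b = refl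
^-distribʳ-* (suc n) a b = trans (cong (a * b *_) (^-distribʳ-* n a b)) (ℕ.[m*n]*[o*p]≡[m*o]*[n*p] a b (a ^ n) (b ^ n))

abstract
  -- Every prime of m occurs in m^(E+1) with exponent at least E + 1, and n < p^n makes each of
  -- these prime powers exceed E. The induction removes one prime of m at a time.
  canonical-^ : ∀ E m → 1 ≤ m → ∃[ qs ] Canonical qs × product qs ≡ m ^ suc E × All (E <_) qs
  canonical-^ E = <-rec _ step
    where
    step : ∀ m → (∀ {k} → k < m → 1 ≤ k → ∃[ qs ] Canonical qs × product qs ≡ k ^ suc E × All (E <_) qs) →
      1 ≤ m → ∃[ qs ] Canonical qs × product qs ≡ m ^ suc E × All (E <_) qs
    step 1 rec _ = [] , [] , sym (ℕ.^-zeroˡ (suc E)) , []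
    step m@(suc (suc _)) rec 1≤m with p , pr , p∣m ← prime-divisor {m} (s≤s (s≤s z≤n)) with remove-prime pr m 1≤m
    ... | zero , m′ , m≡ , p∤m′ = contradiction (subst (p ∣_) (trans m≡ (ℕ.*-identityˡ m′)) p∣m) p∤m′
    ... | suc v , m′ , m≡ , p∤m′
      with qs , cs , qs≡ , E< ← rec {m′} (subst (m′ <_) (sym m≡) (cofactor-< pr v p∤m′)) (∤⇒1≤ p∤m′) =
      p ^ (suc v * suc E) ∷ qs ,
      -- One less than the exponent `suc v * suc E`, as the constructor adds the 1 back.
      ((p ^1+ (E + v * suc E) ∷⟨ pr , (λ p∣ → p∤m′ (prime∣^ (suc E) pr (subst (p ∣_) qs≡ p∣))) ⟩) cs) ,
      trans (cong₂ _*_ (sym (ℕ.^-*-assoc p (suc v) (suc E))) qs≡)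
        (trans (sym (^-distribʳ-* (suc E) (p ^ suc v) m′)) (cong (_^ suc E) (sym m≡))) ,
      ℕ.<-trans (ℕ.≤-trans (ℕ.n<1+n E) (ℕ.m≤n*m (suc E) (suc v))) (n<m^n (prime⇒2≤ pr) (suc v * suc E)) ∷ E<

prime∤product : ∀ {p} → Prime p → ∀ qs → (∀ {q} → q ∈ qs → ¬ p ∣ q) → ¬ p ∣ product qs
prime∤product pr [] _ p∣1 with refl ← ∣1⇒≡1 p∣1 = ¬prime[1] pr
prime∤product pr (q ∷ qs) p∤ p∣ with euclidsLemma q (product qs) pr p∣
... | inj₁ p∣q = p∤ (here refl) p∣q
... | inj₂ p∣qs = prime∤product pr qs (p∤ ∘ there) p∣qs

canonical-tabulate : ∀ {t} (p e : Fin t → ℕ) → (∀ i → Prime (p i)) → (∀ {i k} → p i ≡ p k → i ≡ k) →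
  ∀ {ms} → Canonical ms → (∀ i → ¬ p i ∣ product ms) → Canonical (tabulate (λ i → p i ^ suc (e i)) ++ ms)
canonical-tabulate {zero} p e pr inj cs p∤ms = cs
canonical-tabulate {suc t} p e pr inj {ms} cs p∤ms =
  (p zero ^1+ e zero ∷⟨ pr zero , p₀∤ ⟩)
    (canonical-tabulate (p ∘ suc) (e ∘ suc) (pr ∘ suc) (Fin.suc-injective ∘ inj) cs (p∤ms ∘ suc))
  where
  qs = tabulate (λ i → p (suc i) ^ suc (e (suc i)))
  p₀∤qs : ∀ {q} → q ∈ qs → ¬ p zero ∣ q
  p₀∤qs q∈ p∣ with i , refl ← ∈-tabulate⁻ q∈
    with () ← inj (prime∣prime (pr zero) (pr (suc i)) (prime∣^ (suc (e (suc i))) (pr zero) p∣))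
  p₀∤ : ¬ p zero ∣ product (qs ++ ms)
  p₀∤ p∣ with euclidsLemma (product qs) (product ms) (pr zero) (subst (p zero ∣_) (product-++ qs ms) p∣)
  ... | inj₁ p∣qs = prime∤product (pr zero) qs p₀∤qs p∣qs
  ... | inj₂ p∣ms = p∤ms zero p∣ms

-- Clusters of prime powers with a prescribed coefficient

argmax : ∀ {s} (f : Fin (suc s) → ℕ) → ∃[ i ] ∀ k → f k ≤ f i
argmax {zero} f = zero , λ { zero → ℕ.≤-refl }
argmax {suc s} f with i , f≤ ← argmax (f ∘ suc) with ℕ.≤-total (f zero) (f (suc i))
... | inj₁ f₀≤ = suc i , λ { zero → f₀≤ ; (suc k) → f≤ k }
... | inj₂ ≤f₀ = zero , λ { zero → ℕ.≤-refl ; (suc k) → ℕ.≤-trans (f≤ k) ≤f₀ }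

-- The sum a + b exceeds 3Y/2 while c stays below 4Y/3. For Y ≥ 2 the gap, sharpened by integrality
-- of the hypotheses, leaves room for the extra 1.
1+c<a+b : ∀ {Y a b c} → 2 ≤ Y → 3 * Y < 4 * a → 3 * Y < 4 * b → 3 * c < 4 * Y → suc c < a + b
1+c<a+b {Y} {a} {b} {c} 2≤Y a> b> c< = ℕ.*-cancelˡ-< 12 (suc c) (a + b) (begin-strict
  12 * suc c                              ≡⟨ lem₁ c ⟩
  4 * suc (3 * c) + 8                     ≤⟨ ℕ.+-monoˡ-≤ 8 (ℕ.*-monoʳ-≤ 4 c<) ⟩
  4 * (4 * Y) + 8                         <⟨ ℕ.n<1+n _ ⟩
  suc (4 * (4 * Y) + 8)                   ≤⟨ ℕ.n≤1+n _ ⟩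
  suc (suc (4 * (4 * Y) + 8))             ≡⟨ lem₂ Y ⟩
  16 * Y + 6 + 2 * 2                      ≤⟨ ℕ.+-monoʳ-≤ (16 * Y + 6) (ℕ.*-monoʳ-≤ 2 2≤Y) ⟩
  16 * Y + 6 + 2 * Y                      ≡⟨ lem₃ Y ⟩
  3 * (suc (3 * Y) + suc (3 * Y))         ≤⟨ ℕ.*-monoʳ-≤ 3 (ℕ.+-mono-≤ a> b>) ⟩
  3 * (4 * a + 4 * b)                     ≡⟨ lem₄ a b ⟩
  12 * (a + b)                            ∎)
  where
  open ℕ.≤-Reasoning
  lem₁ : ∀ c → 12 * suc c ≡ 4 * suc (3 * c) + 8
  lem₁ = ℕ-solve-∀
  lem₂ : ∀ Y → suc (suc (4 * (4 * Y) + 8)) ≡ 16 * Y + 6 + 2 * 2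
  lem₂ = ℕ-solve-∀
  lem₃ : ∀ Y → 16 * Y + 6 + 2 * Y ≡ 3 * (suc (3 * Y) + suc (3 * Y))
  lem₃ = ℕ-solve-∀
  lem₄ : ∀ a b → 3 * (4 * a + 4 * b) ≡ 12 * (a + b)
  lem₄ = ℕ-solve-∀

+≤* : ∀ {a b} → 2 ≤ a → 2 ≤ b → a + b ≤ a * b
+≤* {suc (suc a)} {suc (suc b)} (s≤s (s≤s _)) (s≤s (s≤s _)) = subst (suc (suc a) + suc (suc b) ≤_) (lem a b) (ℕ.m≤m+n _ _)
  where
  lem : ∀ a b → suc (suc a) + suc (suc b) + (a + b + a * b) ≡ suc (suc a) * suc (suc b)
  lem = ℕ-solve-∀

∣∸1⇒∣∸ : ∀ {r a b} → 1 ≤ a → a ≤ b → r ∣ a ∸ 1 → r ∣ b ∸ 1 → r ∣ b ∸ a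
∣∸1⇒∣∸ {r} {suc a} {suc b} _ (s≤s a≤b) r∣a r∣b = ∣m+n∣m⇒∣n (subst (r ∣_) (sym (ℕ.m+[n∸m]≡n a≤b)) r∣b) r∣a

-- The part of the construction that sees m only through the bound N. `canonical⁺` allows further
-- prime powers whose primes are at most N or equal to r. The power `r ^ 1` has the shape required
-- by `Canonical`, and `q₀` is kept apart to make the list visibly nonempty.
record Cluster (N : ℕ) (k : ℤ) : Set where
  field
    r : ℕ
    r-prime : Prime r
    N<r : N < r
    q₀ : ℕ
    qs : List ℕ
    j : ℕ
    canonical⁺ : ∀ {ms} → Canonical ms → (∀ {p} → Prime p → N < p → p ≢ r → ¬ p ∣ product ms) →
      Canonical (q₀ ∷ qs ++ ms)
    pairwise : AllPairs (λ q q′ → j < q * q′) (q₀ ∷ qs)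
    j<q*r : All (λ q → j < q * r ^ 1) (q₀ ∷ qs)
    coefficient : ∀ {g} → g ≈[ j ] [1-x]/[1-x^ r ^ 1 ] → mulAll false g (q₀ ∷ qs) j ≡ k

cluster : ∀ N → 2 ≤ N → ∀ k → Cluster N k
cluster N 2≤N k = build k
  where
  P = primes> N
  r = P 0
  R = r ^ 1
  r-prime = primes>-prime N 0
  r≡R : r ≡ R
  r≡R = sym (ℕ.*-identityʳ r)
  3≤R : 3 ≤ R
  3≤R = subst (3 ≤_) r≡R (ℕ.≤-<-trans 2≤N (primes>-> N 0))
  2≤R = ℕ.<⇒≤ 3≤R

  module Powers (s : ℕ) where
    p : Fin (suc s) → ℕ
    p i = P (suc (toℕ i))
    p-prime : ∀ i → Prime (p i)
    p-prime i = primes>-prime N (suc (toℕ i))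
    P-injective : ∀ {i k} → P i ≡ P k → i ≡ k
    P-injective {i} {k} eq with ℕ.<-cmp i k
    ... | tri< i<k _ _ = contradiction eq (ℕ.<⇒≢ (primes>-mono N i<k))
    ... | tri≈ _ i≡k _ = i≡k
    ... | tri> _ _ k<i = contradiction (sym eq) (ℕ.<⇒≢ (primes>-mono N k<i))
    p≢r : ∀ i → p i ≢ r
    p≢r i eq with () ← P-injective {suc (toℕ i)} {0} eq
    p-bound : ∀ i → p i ≤ P (suc (suc s))
    p-bound i = ℕ.<⇒≤ (primes>-mono N (s≤s (Fin.toℕ<n i)))
    close = close-powers p (P (suc (suc s))) R {{>-nonZero (ℕ.<⇒≤ 2≤R)}} (prime⇒2≤ ∘ p-prime) p-bound
      (λ i → prime⇒coprime-∤ (p-prime i) (λ p∣R → p≢r i (prime∣prime (p-prime i) r-prime (prime∣^ 1 (p-prime i) p∣R))))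
    Y = proj₁ close
    e = proj₁ (proj₂ (proj₂ close))
    q : Fin (suc s) → ℕ
    q i = p i ^ suc (e i)
    good : ∀ i → 3 * Y < 4 * q i × 3 * q i < 4 * Y × R ∣ q i ∸ 1
    good = proj₂ (proj₂ (proj₂ close))
    2≤q : ∀ i → 2 ≤ q i
    2≤q i = ℕ.≤-trans (prime⇒2≤ (p-prime i))
      (∣⇒≤ {{>-nonZero (PrimePower.1≤q (p-prime i) (e i))}} (PrimePower.p∣q (p-prime i) (e i)))
    1≤q : ∀ i → 1 ≤ q i
    1≤q i = ℕ.<⇒≤ (2≤q i)
    top = proj₁ (argmax q)
    q≤top : ∀ i → q i ≤ q top
    q≤top = proj₂ (argmax q)
    1+top< : ∀ i l → suc (q top) < q i + q l
    1+top< i l = 1+c<a+b {Y} {q i} {q l} {q top} (proj₁ (proj₂ close)) (proj₁ (good i)) (proj₁ (good l)) (proj₁ (proj₂ (good top)))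

    G = [1-x]/[1-x^ R ]

    -- Serves both j = max q and j = max q + 1. As all q are 1 modulo R, the indices j - q lie in
    -- one residue class, with common coefficient c, and `mulAll-linear` yields d + (s + 1) c.
    from : ∀ {k} j (c d : ℤ) → q top ≤ j → j ≤ suc (q top) → G j ≡ d → (∀ i → G (j ∸ q i) ≡ c) →
      d ℤ.+ ℤ.+ suc s ℤ.* c ≡ k → Cluster N k
    from {k} j c d top≤j j≤ Gj Gj∸q value = record
      { r = r ; r-prime = r-prime ; N<r = primes>-> N 0
      ; q₀ = q zero ; qs = tabulate (q ∘ suc) ; j = j
      ; canonical⁺ = λ cs p∤ → canonical-tabulate p e p-prime (Fin.toℕ-injective ∘ ℕ.suc-injective ∘ P-injective) cs
          (λ i → p∤ (p-prime i) (primes>-> N (suc (toℕ i))) (p≢r i))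
      ; pairwise = AllPairs.tabulate⁺ {f = q} (λ {i} {l} _ → ℕ.<-≤-trans {j} {q i + q l} {q i * q l} (j< i l) (+≤* {q i} {q l} (2≤q i) (2≤q l)))
      ; j<q*r = All.tabulate⁺ {f = q} (λ i → ℕ.<-≤-trans {j} {q i + q i} {q i * R} (j< i i)
          (subst (_≤ q i * R) (trans (ℕ.*-comm (q i) 2) (cong (q i +_) (ℕ.+-identityʳ (q i)))) (ℕ.*-monoʳ-≤ (q i) 2≤R)))
      ; coefficient = λ {g} g≈G → trans
          (mulAll-linear g (tabulate q) j c q≤j j<+ (λ {x} x∈ → trans (g≈G (j ∸ x) (ℕ.m∸n≤m j x)) (G≡c x∈)))
          (trans (cong₂ (λ y n → y ℤ.+ ℤ.+ n ℤ.* c) (trans (g≈G j ℕ.≤-refl) Gj) (length-tabulate q)) value)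
      }
      where
      j< : ∀ i l → j < q i + q l
      j< i l = ℕ.≤-<-trans j≤ (1+top< i l)
      q≤j : ∀ {x} → x ∈ tabulate q → x ≤ j
      q≤j x∈ with i , refl ← ∈-tabulate⁻ {f = q} x∈ = ℕ.≤-trans (q≤top i) top≤j
      j<+ : ∀ {x y} → x ∈ tabulate q → y ∈ tabulate q → j < x + y
      j<+ x∈ y∈ with i , refl ← ∈-tabulate⁻ {f = q} x∈ with l , refl ← ∈-tabulate⁻ {f = q} y∈ = j< i l
      G≡c : ∀ {x} → x ∈ tabulate q → G (j ∸ x) ≡ c
      G≡c x∈ with i , refl ← ∈-tabulate⁻ {f = q} x∈ = Gj∸q i

    R∣top∸q : ∀ i → R ∣ q top ∸ q i
    R∣top∸q i = ∣∸1⇒∣∸ {R} {q i} {q top} (1≤q i) (q≤top i) (proj₂ (proj₂ (good i))) (proj₂ (proj₂ (good top)))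

    top≡ : 1 + (q top ∸ 1) ≡ q top
    top≡ = ℕ.m+[n∸m]≡n (1≤q top)

  build : ∀ k → Cluster N k
  -- Here j is 1 modulo R and j - q is 0, so the coefficient is -1 + (s + 1) = s.
  build (ℤ.+ s) = from (q top) (ℤ.+ 1) ℤ.-1ℤ ℕ.≤-refl (ℕ.n≤1+n _)
    (trans (cong G (sym top≡)) ([1-x]/[1-x^p]-≡1 (proj₂ (proj₂ (good top))) 2≤R))
    (λ i → [1-x]/[1-x^p]-≡0 (R∣top∸q i) 2≤R)
    (cong (λ z → ℤ.-1ℤ ℤ.+ z) (ℤ.*-identityʳ (ℤ.+ suc s)))
    where open Powers s
  -- Here j is 2 modulo R and j - q is 1, so the coefficient is 0 - (s + 1).
  build ℤ.-[1+ s ] = from (suc (q top)) ℤ.-1ℤ (ℤ.+ 0) (ℕ.n≤1+n _) ℕ.≤-refl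
    (trans (cong (G ∘ suc) (sym top≡)) ([1-x]/[1-x^p]-≡2 (proj₂ (proj₂ (good top))) 3≤R))
    (λ i → trans (cong G (ℕ.+-∸-assoc 1 (q≤top i))) ([1-x]/[1-x^p]-≡1 (R∣top∸q i) 2≤R))
    (trans (ℤ.+-identityˡ _) (trans (ℤ.*-comm (ℤ.+ suc s) ℤ.-1ℤ) (ℤ.-1*i≡-i (ℤ.+ suc s))))
    where open Powers s

-- Realising every integer for multiples of m

unitaryProduct : Bool → ℕ → Series
unitaryProduct b n = foldr (λ d → mul (factor (twist b (μ*Pos (divN n d))) d)) one (unitaryDivisors n)

-- The bound `j < m * n` is for Ψ*: in that range multiplication by x^(mn) - 1 is just negation.
unitaryProduct-surjective : ∀ {m} → 1 ≤ m → ∀ k b →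
  ∃[ n ] ∃[ j ] 1 ≤ n × j < m * n × unitaryProduct b (m * n) j ≡ k
unitaryProduct-surjective {m} 1≤m k b = conclude (twist b (isEven (length L))) refl
  where
  -- With N = m + 2 all primes of the cluster exceed m, hence do not divide it, and N ≥ 2 forces r ≥
  -- 3.
  open Cluster (cluster (suc (suc m)) (s≤s (s≤s z≤n)) k)
  R = r ^ 1
  -- The index j is already fixed by the cluster, so m can now be raised until its prime powers
  -- exceed j.
  factorised = canonical-^ j m 1≤m
  ms = proj₁ factorised
  Q = q₀ ∷ qs
  L = Q ++ R ∷ ms

  product-ms : product ms ≡ m ^ suc j
  product-ms = proj₁ (proj₂ (proj₂ factorised))
  j<ms : All (j <_) ms
  j<ms = proj₂ (proj₂ (proj₂ factorised))

  m<p⇒∤ms : ∀ {p} → Prime p → m < p → ¬ p ∣ product ms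
  m<p⇒∤ms {p} pr m<p p∣ = ℕ.<⇒≱ m<p (∣⇒≤ {{>-nonZero 1≤m}} (prime∣^ (suc j) pr (subst (p ∣_) product-ms p∣)))

  m<2+m : m < suc (suc m)
  m<2+m = ℕ.m≤n⇒m≤1+n ℕ.≤-refl

  canonical-R∷ms : Canonical (R ∷ ms)
  canonical-R∷ms = (r ^1+ 0 ∷⟨ r-prime , m<p⇒∤ms r-prime (ℕ.<-trans m<2+m N<r) ⟩) (proj₁ (proj₂ factorised))

  canonical-L : Canonical L
  canonical-L = canonical⁺ canonical-R∷ms p∤
    where
    p∤ : ∀ {p} → Prime p → suc (suc m) < p → p ≢ r → ¬ p ∣ product (R ∷ ms)
    p∤ pr N<p p≢r p∣ with euclidsLemma R (product ms) pr p∣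
    ... | inj₁ p∣R = p≢r (prime∣prime pr r-prime (prime∣^ 1 pr p∣R))
    ... | inj₂ p∣ms = m<p⇒∤ms pr (ℕ.<-trans m<2+m N<p) p∣ms

  1≤L : 1 ≤ product L
  1≤L = canonical⇒1≤ canonical-L

  positive : ∀ {x} → x ∈ L → 1 ≤ x
  positive x∈ = ℕ.n≢0⇒n>0 λ { refl → ℕ.<⇒≢ 1≤L (sym (0∣⇒≡0 (∈⇒∣product x∈))) }

  *->ʳ : ∀ {x y} → 1 ≤ x → j < y → j < x * y
  *->ʳ {x} {y} 1≤x j<y = ℕ.<-≤-trans j<y (ℕ.m≤n*m y x {{>-nonZero 1≤x}})

  pairwise-L : AllPairs (λ x y → j < x * y) L
  pairwise-L = AllPairs.++⁺ pairwise (All.map (*->ʳ (PrimePower.1≤q r-prime 0)) j<ms ∷ pairwise-> j<ms)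
    (All.tabulate λ {q} q∈ → All.lookup j<q*r q∈ ∷ All.map (*->ʳ (positive (∈-++⁺ˡ q∈))) j<ms)
    where
    pairwise-> : ∀ {xs} → All (j <_) xs → AllPairs (λ x y → j < x * y) xs
    pairwise-> [] = []
    pairwise-> (j<x ∷ j<xs) = All.map (*->ʳ (ℕ.≤-<-trans z≤n j<x)) j<xs ∷ pairwise-> j<xs

  -- Up to degree j the powers in `ms` have no effect, R turns 1 - x into (1 - x) / (1 - x^r), and
  -- what remains is the product over the cluster.
  coefficient-L : mulAll false (nfactor true 1) L j ≡ k
  coefficient-L = trans (cong (λ f → f j) (foldr-++ (λ q → mul (nfactor false q)) (nfactor true 1) Q (R ∷ ms)))
    (coefficient λ i i≤j → conv-cong i i (λ _ _ → refl)
      (λ l l≤i → mulAll-< (nfactor true 1) ms l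
        (λ x∈ → ℕ.≤-<-trans (ℕ.≤-trans l≤i i≤j) (All.lookup j<ms x∈)))
      ℕ.≤-refl)

  -- The exponent is j and not j + 1 because the remaining factor m comes from `m * N`.
  N = product Q * (R * m ^ j)

  m*N≡ : m * N ≡ product L
  m*N≡ = begin
    m * (product Q * (R * m ^ j))  ≡⟨ swap m (product Q) R (m ^ j) ⟩
    product Q * (R * (m * m ^ j))  ≡⟨ cong (λ x → product Q * (R * x)) product-ms ⟨
    product Q * product (R ∷ ms)   ≡⟨ product-++ Q (R ∷ ms) ⟨
    product L                      ∎
    where
    open ≡-Reasoning
    swap : ∀ a b c d → a * (b * (c * d)) ≡ b * (c * (a * d))
    swap = ℕ-solve-∀

  j<L : j < product L
  j<L = ℕ.<-≤-trans (All.head j<q*r) (∣⇒≤ {{>-nonZero 1≤L}}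
    (subst (q₀ * R ∣_) (sym (product-++ Q (R ∷ ms)))
      (*-pres-∣ (m∣m*n {q₀} (product qs)) (m∣m*n {R} (product ms)))))

  factor⇒1≤ : ∀ {n} → 1 ≤ m * n → 1 ≤ n
  factor⇒1≤ {zero} 1≤ = contradiction 1≤ (ℕ.<⇒≱ (s≤s (ℕ.≤-reflexive (ℕ.*-zeroʳ m))))
  factor⇒1≤ {suc n} _ = s≤s z≤n

  Goal = ∃[ n ] ∃[ j ] 1 ≤ n × j < m * n × unitaryProduct b (m * n) j ≡ k

  finish : ∀ {x xs n} → m * n ≡ product (x ∷ xs) → j < product (x ∷ xs) → Canonical (x ∷ xs) →
    AllPairs (λ y z → j < y * z) (x ∷ xs) → twist b (isEven (length (x ∷ xs))) ≡ true →
    mulAll false (nfactor true 1) (x ∷ xs) j ≡ k → Goal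
  finish {x} {xs} {n} mn≡ j< cs pw σ≡ coeff =
    n , j , factor⇒1≤ (subst (1 ≤_) (sym mn≡) (canonical⇒1≤ cs)) , subst (j <_) (sym mn≡) j< ,
    trans (cong (λ N → unitaryProduct b N j) mn≡)
      (trans (prod-unitaryDivisors j b cs pw j ℕ.≤-refl)
        (trans (cong (λ σ → mulAll (not σ) (nfactor σ 1) (x ∷ xs) j) σ≡) coeff))

  conclude : ∀ σ → twist b (isEven (length L)) ≡ σ → Goal
  conclude true σ≡ = finish m*N≡ j<L canonical-L pairwise-L σ≡ coefficient-L
  -- One more prime, too large to affect the coefficient of x^j, flips the sign of the exponents.
  conclude false σ≡ =
    finish {n = N * p ^ 1} (trans (sym (ℕ.*-assoc m N (p ^ 1))) (trans (cong (_* p ^ 1) m*N≡) (ℕ.*-comm (product L) (p ^ 1))))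
      (*->ʳ 1≤p j<L)
      ((p ^1+ 0 ∷⟨ pr , (λ p∣L → ℕ.<⇒≱ L<p (∣⇒≤ {{>-nonZero 1≤L}} p∣L)) ⟩) canonical-L)
      (All.tabulate (λ {x} x∈ → subst (j <_) (ℕ.*-comm x (p ^ 1)) (*->ʳ (positive x∈) j<p^1)) ∷ pairwise-L)
      (trans (twist-notʳ b (isEven (length L))) (cong not σ≡))
      (trans (nfactor-false-< 1≤p (mulAll false (nfactor true 1) L) j j<p^1) coefficient-L)
    where
    large = prime-above (product L + j)
    p = proj₁ large
    pr = proj₁ (proj₂ large)
    L+j<p = proj₂ (proj₂ large)
    1≤p = PrimePower.1≤q pr 0
    L<p : product L < p
    L<p = ℕ.≤-<-trans (ℕ.m≤m+n (product L) j) L+j<p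
    j<p^1 : j < p ^ 1
    j<p^1 = subst (j <_) (sym (ℕ.*-identityʳ p)) (ℕ.≤-<-trans (ℕ.m≤n+m j (product L)) L+j<p)

xPowMinus1-> : ∀ n f j → j < n → mul (xPowMinus1 n) f j ≡ ℤ.- f j
xPowMinus1-> n f j j<n = begin
  mul (xPowMinus1 n) f j           ≡⟨ ℤ.neg-involutive _ ⟨
  ℤ.- (ℤ.- mul (xPowMinus1 n) f j) ≡⟨ cong ℤ.-_ (mul-negˡ (xPowMinus1 n) f j) ⟨
  ℤ.- mul (nfactor true n) f j     ≡⟨ cong ℤ.-_ (mul-nfactor-true n f j) ⟩
  ℤ.- (f j ℤ.- shift n f j)        ≡⟨ cong (λ z → ℤ.- (f j ℤ.- z)) (shift-> f j<n) ⟩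
  ℤ.- (f j ℤ.- ℤ.+ 0)              ≡⟨ cong ℤ.-_ (ℤ.+-identityʳ (f j)) ⟩
  ℤ.- f j                          ∎
  where open ≡-Reasoning

theorem3 : (m : ℕ) → 1 ≤ m → (k : ℤ) →
    (∃[ n ] ∃[ j ] (1 ≤ n × a* (m * n) j ≡ k)) ×
    (∃[ n ] ∃[ j ] (1 ≤ n × c* (m * n) j ≡ k))
theorem3 m 1≤m k
  with n , j , 1≤n , _ , a≡k ← unitaryProduct-surjective 1≤m k true
  -- The target is -k, since the factor x^(mn′) - 1 of Ψ* negates every coefficient of index below
  -- mn′.
  with n′ , j′ , 1≤n′ , j′<mn′ , c≡-k ← unitaryProduct-surjective 1≤m (ℤ.- k) false =
  (n , j , 1≤n , a≡k) ,
  (n′ , j′ , 1≤n′ ,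
    trans (xPowMinus1-> (m * n′) (unitaryProduct false (m * n′)) j′ j′<mn′) (trans (cong ℤ.-_ c≡-k) (ℤ.neg-involutive k)))
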